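{- Let $L$ be a finite simple connected graph with minimal valency one or two. Then $L$ is star-transitive and st(edge)-transitive if and only if one of the following holds: (1) $L$ is a complete bipartite graph $K_{1,n}$ for some $n\ge 1$; (2) $L$ is a cycle of length $n$ for some $n\ge 3$; or (3) there exists a locally fully symmetric, arc-transitive graph $\Sigma$ of valency at least three such that $L$ can be obtained by subdividing each edge of $\Sigma$ with a new vertex of valency two.
   Context: All graphs are finite. A graph $\Sigma$ is arc-transitive if $\operatorname{Aut}(\Sigma)$ is transitive on arcs (directed edges), and locally fully symmetric if for each vertex $v$ the stabiliser of $v$ in $\operatorname{Aut}(\Sigma)$ induces the full symmetric group on the set of neighbours of $v$. Open stars. For a vertex $v$, $\operatorname{st}(v)$ is the union of $\{v\}$ and the set of edges incident to $v$. For an edge $\{u,v\}$, $\operatorname{st}(\{u,v\})$ is the union of $\{u\}$, $\{v\}$ and the set of all edges incident to at least one of $u,v$. A star isomorphism $\varphi:\operatorname{st}(v_1)\to\operatorname{st}(v_2)$ is a bijection with $\varphi(v_1)=v_2$. An edge-star isomorphism $\varphi:\operatorname{st}(\{u_1,v_1\})\to\operatorname{st}(\{u_2,v_2\})$ is a bijection that maps the vertices $u_1,v_1$ (in some order) to the vertices $u_2,v_2$ and is incidence-preserving: an edge $f\in\operatorname{st}(\{u_1,v_1\})$ is incident to $u_1$ iff $\varphi(f)$ is incident to $\varphi(u_1)$, and incident to $v_1$ iff $\varphi(f)$ is incident to $\varphi(v_1)$. (Adjacencies among the neighbours are not required to be preserved.) A simple graph $L$ is star-transitive if for all vertices $v_1,v_2$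 and every star isomorphism $\varphi:\operatorname{st}(v_1)\to\operatorname{st}(v_2)$ there is $\psi\in \operatorname{Aut}(L)$ with $\psi(v_1)=\varphi(v_1)$ and $\psi(f)=\varphi(f)$ for every edge $f\in\operatorname{st}(v_1)$. $L$ is st(edge)-transitive if for all edges $\{u_1,v_1\},\{u_2,v_2\}$ and every edge-star isomorphism $\varphi:\operatorname{st}(\{u_1,v_1\})\to\operatorname{st}(\{u_2,v_2\})$ there is $\psi\in \operatorname{Aut}(L)$ with $\psi(u_1)=\varphi(u_1)$, $\psi(v_1)=\varphi(v_1)$ and $\psi(f)=\varphi(f)$ for every edge $f\in\operatorname{st}(\{u_1,v_1\})$.
   Formalization: In (3), Σ may have parallel edges (no loops) and the neighbours of a vertex are counted once per edge; with Σ simple the claim fails for K_{2,n}, n ≥ 3, which subdivides n parallel edges, and with neighbours as bare vertices it fails for doubled cycles. -}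

module Defs where

open import Data.Bool.Base using (Bool; true; false)
import Data.Bool.Properties as Bool
open import Data.Empty using (⊥; ⊥-elim-irr)
open import Data.Fin.Base as Fin using (Fin; toℕ; splitAt)
open import Data.Fin.Permutation using (Permutation′; _⟨$⟩ʳ_)
import Data.Fin.Properties as Fin
open import Data.Irrelevant using ([_])
open import Data.Nat.Base using (ℕ; suc; _+_; _≤_; _≥_; s≤s)
import Data.Nat.Properties as ℕ
open import Data.Product.Base using (∃-syntax; _×_; _,_; proj₁; proj₂)
open import Data.Refinement.Base using (Refinement; Refinement-syntax; value; _,_)
open import Data.Sum.Base as Sum using (_⊎_; inj₁; inj₂; [_,_]′)
open import Data.Vec.Base using (count; allFin)
open import Function.Base using (const; _on_)
open import Function.Bundles using (_↔_; _⇔_; module Inverse; module Equivalence)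
open import Level using (0ℓ)
open import Relation.Binary.Construct.Closure.ReflexiveTransitive using (Star)
open import Relation.Binary.Core using (Rel)
open import Relation.Binary.Definitions using (Symmetric; Irreflexive; Decidable; tri<; tri≈; tri>)
open import Relation.Binary.PropositionalEquality.Core using (_≡_; _≢_; refl; sym; trans; cong; subst)
open import Relation.Nullary.Decidable using (no; _×-dec_; _⊎-dec_; ¬?)
open import Relation.Nullary.Negation.Core using (¬_)

------------------------------------------------------------------------
-- Finite simple graphs

record SimpleGraph : Set₁ where
  field
    order    : ℕ
    _~_      : Rel (Fin order) 0ℓ
    _~?_     : Decidable _~_
    ~-sym    : Symmetric _~_
    ~-irrefl : Irreflexive _≡_ _~_

  Vertex : Set
  Vertex = Fin order

  valency : Vertex → ℕ
  valency v = count (v ~?_) (allFin order)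

open SimpleGraph using (valency)

Connected : SimpleGraph → Set
Connected G = ∀ u v → Star _~_ u v
  where open SimpleGraph G

HasMinimalValency : SimpleGraph → ℕ → Set
HasMinimalValency G k = (∃[ v ] valency G v ≡ k) × (∀ v → k ≤ valency G v)

record _≅_ (G H : SimpleGraph) : Set where
  private
    module G = SimpleGraph G
    module H = SimpleGraph H
  field
    bij      : G.Vertex ↔ H.Vertex
    preserve : ∀ u v → (u G.~ v) ⇔ (Inverse.to bij u H.~ Inverse.to bij v)

Aut : SimpleGraph → Set
Aut G = G ≅ G

module _ (G : SimpleGraph) where
  open SimpleGraph G using (_~_; ~-sym; ~-irrefl) renaming (Vertex to V)

  -- An unordered pair {u , v} of adjacent vertices is stored with its smaller
  -- element first and with irrelevant proofs, so that _≡_ is equality of edges.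
  Edge : Set
  Edge = Refinement (V × V) λ (u , v) → (u Fin.< v) × (u ~ v)

  lo hi : Edge → V
  lo e = proj₁ (value e)
  hi e = proj₂ (value e)

  infix 4 _∈ₑ_
  _∈ₑ_ : V → Edge → Set
  x ∈ₑ e = x ≡ lo e ⊎ x ≡ hi e

  mkEdge : (u v : V) → .(u ~ v) → Edge
  mkEdge u v u~v with Fin.<-cmp u v
  ... | tri< u<v _ _ = (u , v) , [ u<v , u~v ]
  ... | tri≈ _ u≡v _ = ⊥-elim-irr (~-irrefl u≡v u~v)
  ... | tri> _ _ v<u = (v , u) , [ v<u , ~-sym u~v ]

  -- Open stars contain both vertices and edges.
  data Cell : Set where
    vertex : V → Cell
    edge   : Edge → Cell

  Incident : Cell → Cell → Set
  Incident (vertex x) (edge f) = x ∈ₑ f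
  Incident _          _        = ⊥

  actVertex : Aut G → V → V
  actVertex ψ = Inverse.to (_≅_.bij ψ)

  actEdge : Aut G → Edge → Edge
  actEdge ψ ((u , v) , [ p ]) =
    mkEdge (actVertex ψ u) (actVertex ψ v)
           (Equivalence.to (_≅_.preserve ψ u v) (proj₂ p))

  act : Aut G → Cell → Cell
  act ψ (vertex v) = vertex (actVertex ψ v)
  act ψ (edge e)   = edge (actEdge ψ e)

  InStar : V → Cell → Set
  InStar v (vertex w) = w ≡ v
  InStar v (edge f)   = v ∈ₑ f

  InEdgeStar : Edge → Cell → Set
  InEdgeStar e (vertex w) = w ∈ₑ e
  InEdgeStar e (edge f)   = lo e ∈ₑ f ⊎ hi e ∈ₑ f

  st : V → Set
  st v = [ c ∈ Cell ∣ InStar v c ]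

  stₑ : Edge → Set
  stₑ e = [ c ∈ Cell ∣ InEdgeStar e c ]

  centre : (v : V) → st v
  centre v = vertex v , [ refl ]

  loEnd hiEnd : (e : Edge) → stₑ e
  loEnd e = vertex (lo e) , [ inj₁ refl ]
  hiEnd e = vertex (hi e) , [ inj₂ refl ]

  record StarIso (v₁ v₂ : V) : Set where
    field
      bij       : st v₁ ↔ st v₂
    open Inverse bij public using (to)
    field
      to-centre : to (centre v₁) ≡ centre v₂

  -- The incidence conditions range over all cells c of the star; when c is a
  -- vertex they hold trivially, since vertices are then sent to vertices.
  record EdgeStarIso (e₁ e₂ : Edge) : Set where
    field
      bij         : stₑ e₁ ↔ stₑ e₂
    open Inverse bij public using (to)
    field
      to-ends     : (to (loEnd e₁) ≡ loEnd e₂ × to (hiEnd e₁) ≡ hiEnd e₂)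
                  ⊎ (to (loEnd e₁) ≡ hiEnd e₂ × to (hiEnd e₁) ≡ loEnd e₂)
      incident-lo : ∀ c → Incident (vertex (lo e₁)) (value c)
                        ⇔ Incident (value (to (loEnd e₁))) (value (to c))
      incident-hi : ∀ c → Incident (vertex (hi e₁)) (value c)
                        ⇔ Incident (value (to (hiEnd e₁))) (value (to c))

  StarTransitive : Set
  StarTransitive =
    ∀ v₁ v₂ (φ : StarIso v₁ v₂) →
    ∃[ ψ ] ((c : st v₁) → act ψ (value c) ≡ value (StarIso.to φ c))

  StEdgeTransitive : Set
  StEdgeTransitive =
    ∀ e₁ e₂ (φ : EdgeStarIso e₁ e₂) →
    ∃[ ψ ] ((c : stₑ e₁) → act ψ (value c) ≡ value (EdgeStarIso.to φ c))

------------------------------------------------------------------------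
-- Complete bipartite graphs and cycles

CompleteBipartite : ℕ → ℕ → SimpleGraph
CompleteBipartite m n = record
  { order    = m + n
  ; _~_      = _≢_ on side
  ; _~?_     = λ i j → ¬? (side i Bool.≟ side j)
  ; ~-sym    = λ i≁j eq → i≁j (sym eq)
  ; ~-irrefl = λ { refl i≁i → i≁i refl }
  }
  where
  side : Fin (m + n) → Bool
  side i = [ const true , const false ]′ (splitAt m i)

CyclicSuc : ∀ {n} → Rel (Fin n) 0ℓ
CyclicSuc {n} i j = suc (toℕ i) ≡ toℕ j ⊎ (suc (toℕ i) ≡ n × toℕ j ≡ 0)

Cycle : ∀ n → n ≥ 3 → SimpleGraph
Cycle n n≥3 = record
  { order    = n
  ; _~_      = λ i j → CyclicSuc i j ⊎ CyclicSuc j i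
  ; _~?_     = λ i j → suc? i j ⊎-dec suc? j i
  ; ~-sym    = Sum.swap
  ; ~-irrefl = λ { refl → [ suc-irrefl n≥3 , suc-irrefl n≥3 ]′ }
  }
  where
  suc? : Decidable (CyclicSuc {n})
  suc? i j = (suc (toℕ i) ℕ.≟ toℕ j)
         ⊎-dec ((suc (toℕ i) ℕ.≟ n) ×-dec (toℕ j ℕ.≟ 0))

  suc-irrefl : ∀ {n} → n ≥ 3 → {i : Fin n} → ¬ CyclicSuc i i
  suc-irrefl _   (inj₁ eq)        = ℕ.1+n≢n eq
  suc-irrefl n≥3 (inj₂ (eq , i≡0))
    with s≤s () ← subst (3 ≤_) (trans (sym eq) (cong suc i≡0)) n≥3

------------------------------------------------------------------------
-- Finite graphs, possibly with multiple edges

-- Parallel edges have to be allowed: K₂,ₙ with n ≥ 3 arises by subdividing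
-- the n parallel edges of a graph on two vertices.  Loops are left out since
-- subdividing one never yields a simple graph.

record Multigraph : Set where
  field
    order size : ℕ
    end₁ end₂  : Fin size → Fin order   -- the order of the two ends is arbitrary
    loopless   : ∀ e → end₁ e ≢ end₂ e

  infix 4 _∈ᵉ_ _∈ᵉ?_
  _∈ᵉ_ : Fin order → Fin size → Set
  v ∈ᵉ e = v ≡ end₁ e ⊎ v ≡ end₂ e

  _∈ᵉ?_ : Decidable _∈ᵉ_
  v ∈ᵉ? e = (v Fin.≟ end₁ e) ⊎-dec (v Fin.≟ end₂ e)

  degree : Fin order → ℕ
  degree v = count (v ∈ᵉ?_) (allFin size)

  -- The neighbours of v, counted with multiplicity: one for each edge at v.
  -- In the absence of parallel edges these are just the adjacent vertices.
  Neighbour : Fin order → Set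
  Neighbour v = [ e ∈ Fin size ∣ v ∈ᵉ e ]

  -- As there are no loops, a directed edge is an edge with its initial vertex.
  Arc : Set
  Arc = Refinement (Fin order × Fin size) λ (v , e) → v ∈ᵉ e

  record Automorphism : Set where
    field
      onVertices : Permutation′ order
      onEdges    : Permutation′ size
      incidence  : ∀ v e → (v ∈ᵉ e) ⇔ (onVertices ⟨$⟩ʳ v ∈ᵉ onEdges ⟨$⟩ʳ e)

  open Automorphism public

HasValency : Multigraph → ℕ → Set
HasValency Γ k = ∀ v → Multigraph.degree Γ v ≡ k

ArcTransitive : Multigraph → Set
ArcTransitive Γ =
  ∀ (a b : Arc) →
  ∃[ α ] (onVertices α ⟨$⟩ʳ proj₁ (value a) ≡ proj₁ (value b)
        × onEdges α ⟨$⟩ʳ proj₂ (value a) ≡ proj₂ (value b))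
  where open Multigraph Γ

LocallyFullySymmetric : Multigraph → Set
LocallyFullySymmetric Γ =
  ∀ v (π : Neighbour v ↔ Neighbour v) →
  ∃[ α ] (onVertices α ⟨$⟩ʳ v ≡ v
        × (∀ x → onEdges α ⟨$⟩ʳ value x ≡ value (Inverse.to π x)))
  where open Multigraph Γ

-- The new vertex of valency two on the edge e is joined to both ends of e.

Subdivision : Multigraph → SimpleGraph
Subdivision Γ = record
  { order    = order + size
  ; _~_      = Joined on splitAt order
  ; _~?_     = λ i j → joined? (splitAt order i) (splitAt order j)
  ; ~-sym    = λ {i} {j} → joined-sym (splitAt order i) (splitAt order j)
  ; ~-irrefl = λ { {i} refl → joined-irrefl (splitAt order i) }
  }
  where
  open Multigraph Γ

  Joined : Rel (Fin order ⊎ Fin size) 0ℓ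
  Joined (inj₁ v) (inj₂ e) = v ∈ᵉ e
  Joined (inj₂ e) (inj₁ v) = v ∈ᵉ e
  Joined (inj₁ _) (inj₁ _) = ⊥
  Joined (inj₂ _) (inj₂ _) = ⊥

  joined? : Decidable Joined
  joined? (inj₁ v) (inj₂ e) = v ∈ᵉ? e
  joined? (inj₂ e) (inj₁ v) = v ∈ᵉ? e
  joined? (inj₁ _) (inj₁ _) = no λ ()
  joined? (inj₂ _) (inj₂ _) = no λ ()

  joined-sym : ∀ x y → Joined x y → Joined y x
  joined-sym (inj₁ _) (inj₂ _) p = p
  joined-sym (inj₂ _) (inj₁ _) p = p

  joined-irrefl : ∀ x → ¬ Joined x x
  joined-irrefl (inj₁ _) ()
  joined-irrefl (inj₂ _) ()

-- Call G neighbour-transitive if every bijection between the neighbourhoods of two vertices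
-- extends to an automorphism.  This is star-transitivity without edges, and it implies
-- st(edge)-transitivity as soon as each edge has an end with at most two neighbours, since the
-- action around that end is then forced.
--
-- In a neighbour-transitive graph the neighbours of a common vertex have equal valency.  Next to
-- a leaf this gives a star.  If v has valency two and its neighbours valency k, connectedness
-- spreads the pattern: every vertex has valency 2 or k, and every edge joins one kind to the
-- other.  For k = 2 the graph is a cycle, and for k ≥ 3 the vertices of valency two subdivide
-- the edges of a k-valent multigraph, to which the automorphisms descend.
--
-- Conversely, a bijection between neighbourhoods extends in a star by permuting the leaves, in a
-- cycle because following walks from two arcs identifies it with the same standard cycle, and in
-- a subdivision by composing an arc-transitivity with a local symmetry.

module Submission where

open import Defs
open import Data.Empty using (⊥-elim)
open import Data.Fin.Base as Fin using (Fin; zero; suc; toℕ; fromℕ<; splitAt; _↑ˡ_; _↑ʳ_)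
open import Data.Fin.Permutation using (_⟨$⟩ʳ_; permutation; ↔⇒≡)
import Data.Fin.Properties as Fin
open import Data.Irrelevant using ([_])
open import Data.Nat.Base using (ℕ; zero; suc; _≤_; _<_; _≥_; z≤n; s≤s)
import Data.Nat.Properties as ℕ
open import Data.Product.Base using (Σ-syntax; ∃-syntax; _×_; _,_; proj₁; proj₂)
open import Data.Refinement.Base using (Refinement; value; _,_)
open import Data.Sum.Base as Sum using (_⊎_; inj₁; inj₂; [_,_]′)
open import Data.Vec.Base using (count; allFin; tabulate)
open import Function.Base using (_∘_; id)
open import Function.Bundles using (_↔_; _⇔_; mk⇔; mk↔ₛ′; module Inverse; module Equivalence)
open import Relation.Binary.Construct.Closure.ReflexiveTransitive using (Star; ε; _◅_)
open import Relation.Binary.Definitions using (tri<; tri≈; tri>)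
open import Relation.Binary.PropositionalEquality
  using (_≡_; _≢_; refl; sym; trans; cong; subst; subst₂; ≢-sym)
open import Relation.Nullary.Decidable using (yes; no; recompute; _⊎-dec_)
open import Relation.Nullary.Negation.Core using (¬_; contradiction)
open import Relation.Unary using (Decidable)

-- Partial bijections

infix 3 _⇿_

-- Both maps are total, so they apply and compose without membership proofs. Their values outside
-- `P` and `Q` are unconstrained.
record _⇿_ {A B : Set} (P : A → Set) (Q : B → Set) : Set where
  field
    to      : A → B
    from    : B → A
    to-∈    : ∀ {a} → P a → Q (to a)
    from-∈  : ∀ {b} → Q b → P (from b)
    from-to : ∀ {a} → P a → from (to a) ≡ a
    to-from : ∀ {b} → Q b → to (from b) ≡ b

  to-injective : ∀ {a a′} → P a → P a′ → to a ≡ to a′ → a ≡ a′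
  to-injective p p′ eq = trans (sym (from-to p)) (trans (cong from eq) (from-to p′))

open _⇿_

⇿-sym : {A B : Set} {P : A → Set} {Q : B → Set} → P ⇿ Q → Q ⇿ P
⇿-sym β = record
  { to = from β ; from = to β ; to-∈ = from-∈ β ; from-∈ = to-∈ β
  ; from-to = to-from β ; to-from = from-to β }

⇿-trans : {A B C : Set} {P : A → Set} {Q : B → Set} {R : C → Set} →
          P ⇿ Q → Q ⇿ R → P ⇿ R
⇿-trans β γ = record
  { to      = to γ ∘ to β
  ; from    = from β ∘ from γ
  ; to-∈    = to-∈ γ ∘ to-∈ β
  ; from-∈  = from-∈ β ∘ from-∈ γ
  ; from-to = λ p → trans (cong (from β) (from-to γ (to-∈ β p))) (from-to β p)
  ; to-from = λ r → trans (cong (to γ) (to-from β (from-∈ γ r))) (to-from γ r)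
  }

-- Serves to cut a bijection between stars down to the edges at a single vertex.
⇿-restrict : {A B : Set} {P P′ : A → Set} {Q Q′ : B → Set} (β : P ⇿ Q) →
             (∀ {a} → P′ a → P a) → (∀ {b} → Q′ b → Q b) →
             (∀ {a} → P′ a → Q′ (to β a)) → (∀ {b} → Q′ b → P′ (from β b)) →
             P′ ⇿ Q′
⇿-restrict β P′⊆P Q′⊆Q to′ from′ = record
  { to = to β ; from = from β ; to-∈ = to′ ; from-∈ = from′
  ; from-to = from-to β ∘ P′⊆P ; to-from = to-from β ∘ Q′⊆Q }

value-injective : {A : Set} {P : A → Set} {x y : Refinement A P} → value x ≡ value y → x ≡ y
value-injective {x = _ , _} {y = _ , _} refl = refl

-- A `Refinement` stores its proof irrelevantly; decidability is what makes that proof usable by the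
-- inverse laws.
⇿⇒↔ : {A B : Set} {P : A → Set} {Q : B → Set} → Decidable P → Decidable Q →
      P ⇿ Q → Refinement A P ↔ Refinement B Q
⇿⇒↔ P? Q? β = mk↔ₛ′
  (λ (a , [ p ]) → to β a , [ to-∈ β p ])
  (λ (b , [ q ]) → from β b , [ from-∈ β q ])
  (λ (b , [ q ]) → value-injective (to-from β (recompute (Q? b) q)))
  (λ (a , [ p ]) → value-injective (from-to β (recompute (P? a) p)))

module _ {A : Set} {P Q : A → Set} (P? : Decidable P) (f : Refinement A P → Refinement A Q) where

  extend : A → A
  extend a with P? a
  ... | yes p = value (f (a , [ p ]))
  -- A default off `P`, where a partial bijection is not constrained.
  ... | no  _ = a

  extend-∈ : ∀ x → extend (value x) ≡ value (f x)
  extend-∈ (a , [ p ]) with P? a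
  ... | yes _ = refl
  ... | no ¬p = contradiction (recompute (P? a) p) ¬p

↔⇒⇿ : {A : Set} {P Q : A → Set} → Decidable P → Decidable Q →
      Refinement A P ↔ Refinement A Q → P ⇿ Q
↔⇒⇿ {A} {P} {Q} P? Q? φ = record
  { to      = extend P? φ.to
  ; from    = extend Q? φ.from
  ; to-∈    = λ p → ∈′ P? Q? φ.to (_ , [ p ])
  ; from-∈  = λ q → ∈′ Q? P? φ.from (_ , [ q ])
  ; from-to = λ p → inv P? Q? φ.to φ.from φ.strictlyInverseʳ (_ , [ p ])
  ; to-from = λ q → inv Q? P? φ.from φ.to φ.strictlyInverseˡ (_ , [ q ])
  }
  where
  module φ = Inverse φ

  ∈′ : {R S : A → Set} (R? : Decidable R) (S? : Decidable S) →
       (f : Refinement A R → Refinement A S) → ∀ x → S (extend R? f (value x))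
  ∈′ {S = S} R? S? f x with y , [ s ] ← f x in eq =
    subst S (sym (trans (extend-∈ R? f x) (cong value eq))) (recompute (S? y) s)

  inv : {R S : A → Set} (R? : Decidable R) (S? : Decidable S)
        (f : Refinement A R → Refinement A S) (g : Refinement A S → Refinement A R) →
        (∀ x → g (f x) ≡ x) → ∀ x → extend S? g (extend R? f (value x)) ≡ value x
  inv R? S? f g gf x =
    trans (cong (extend S? g) (extend-∈ R? f x))
          (trans (extend-∈ S? g (f x)) (cong value (gf x)))

swap : ∀ {n} → Fin n → Fin n → Fin n → Fin n
swap a b x with x Fin.≟ a | x Fin.≟ b
... | yes _ | _     = b
... | no  _ | yes _ = a
... | no  _ | no  _ = x

swap-left : ∀ {n} (a b : Fin n) → swap a b a ≡ b
swap-left a b with a Fin.≟ a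
... | yes _ = refl
... | no  q = contradiction refl q

swap-right : ∀ {n} (a b : Fin n) → swap a b b ≡ a
swap-right a b with b Fin.≟ a | b Fin.≟ b
... | yes b≡a | _     = b≡a
... | no  _   | yes _ = refl
... | no  _   | no  q = contradiction refl q

swap-other : ∀ {n} {a b x : Fin n} → x ≢ a → x ≢ b → swap a b x ≡ x
swap-other {a = a} {b} {x} x≢a x≢b with x Fin.≟ a | x Fin.≟ b
... | yes p | _     = contradiction p x≢a
... | no  _ | yes q = contradiction q x≢b
... | no  _ | no  _ = refl

swap-involutive : ∀ {n} (a b x : Fin n) → swap a b (swap a b x) ≡ x
swap-involutive a b x with x Fin.≟ a | x Fin.≟ b
... | yes p | _     = trans (swap-right a b) (sym p)
... | no  _ | yes q = trans (swap-left a b) (sym q)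
... | no  p | no  q = swap-other p q

-- Transpositions are the only local symmetries that have to be built by hand: they compare two
-- neighbours of one vertex and redirect one edge to another.
swap-⇿ : ∀ {n} {P : Fin n → Set} {a b} → P a → P b → P ⇿ P
swap-⇿ {P = P} {a} {b} Pa Pb = record
  { to = swap a b ; from = swap a b ; to-∈ = swap-∈ ; from-∈ = swap-∈
  ; from-to = λ _ → swap-involutive a b _ ; to-from = λ _ → swap-involutive a b _ }
  where
  swap-∈ : ∀ {x} → P x → P (swap a b x)
  swap-∈ {x} Px with x Fin.≟ a | x Fin.≟ b
  ... | yes _ | _     = Pb
  ... | no  _ | yes _ = Pa
  ... | no  _ | no  _ = Px

-- Counting

-- A bijection of `Fin k` with the elements of `P`. `index` may look at the proof, but
-- `element-index` and injectivity determine its value.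
record Enumeration {n : ℕ} (P : Fin n → Set) (k : ℕ) : Set where
  field
    element           : Fin k → Fin n
    element-∈         : ∀ i → P (element i)
    element-injective : ∀ {i j} → element i ≡ element j → i ≡ j
    index             : ∀ x → P x → Fin k
    element-index     : ∀ x p → element (index x p) ≡ x

  index-injective : ∀ {x y} p q → index x p ≡ index y q → x ≡ y
  index-injective p q eq =
    trans (sym (element-index _ p)) (trans (cong element eq) (element-index _ q))

open Enumeration

-- `allFin n` is generalised to `tabulate f` so that the induction can pass to `f ∘ suc`.
enumerate-tabulate : {A : Set} {P : A → Set} (P? : Decidable P) {n : ℕ} (f : Fin n → A) →
                     Enumeration (P ∘ f) (count P? (tabulate f))
enumerate-tabulate P? {zero} f = record
  { element = λ () ; element-∈ = λ () ; element-injective = λ { {()} }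
  ; index = λ () ; element-index = λ () }
enumerate-tabulate {P = P} P? {suc n} f with P? (f zero) | enumerate-tabulate P? (f ∘ suc)
... | yes p₀ | E = record
  { element           = λ { zero → zero ; (suc i) → suc (element E i) }
  ; element-∈         = λ { zero → p₀ ; (suc i) → element-∈ E i }
  ; element-injective = λ
      { {zero}  {zero}  _  → refl
      ; {suc i} {suc j} eq → cong suc (element-injective E (Fin.suc-injective eq)) }
  ; index             = λ { zero _ → zero ; (suc x) p → suc (index E x p) }
  ; element-index     = λ { zero _ → refl ; (suc x) p → cong suc (element-index E x p) }
  }
... | no ¬p₀ | E = record
  { element           = suc ∘ element E
  ; element-∈         = element-∈ E
  ; element-injective = element-injective E ∘ Fin.suc-injective
  ; index             = λ { zero p → contradiction p ¬p₀ ; (suc x) p → index E x p }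
  ; element-index     = λ { zero p → contradiction p ¬p₀
                          ; (suc x) p → cong suc (element-index E x p) }
  }

enumerate : ∀ {n} {P : Fin n → Set} (P? : Decidable P) → Enumeration P (count P? (allFin n))
enumerate P? = enumerate-tabulate P? id

enumerate-≡ : ∀ {n k} {P : Fin n → Set} (P? : Decidable P) →
              count P? (allFin n) ≡ k → Enumeration P k
enumerate-≡ P? refl = enumerate P?

-- `f` induces an injection between the index sets of the two enumerations. It receives the
-- membership proof because maps such as `index` depend on one.
count-≤ : ∀ {m n} {P : Fin m → Set} {Q : Fin n → Set} (P? : Decidable P) (Q? : Decidable Q) →
          (f : ∀ x → P x → Fin n) → (∀ x p → Q (f x p)) →
          (∀ {x y} p q → f x p ≡ f y q → x ≡ y) →
          count P? (allFin m) ≤ count Q? (allFin n)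
count-≤ P? Q? f f-∈ f-injective = Fin.injective⇒≤ {f = λ i → index F (f _ (element-∈ E i)) (f-∈ _ _)}
  λ eq → element-injective E (f-injective _ _ (index-injective F _ _ eq))
  where
  E = enumerate P?
  F = enumerate Q?

⇿⇒count-≡ : ∀ {m n} {P : Fin m → Set} {Q : Fin n → Set} (P? : Decidable P) (Q? : Decidable Q) →
            P ⇿ Q → count P? (allFin m) ≡ count Q? (allFin n)
⇿⇒count-≡ P? Q? β = ℕ.≤-antisym
  (count-≤ P? Q? (λ x _ → to β x) (λ _ → to-∈ β) (to-injective β))
  (count-≤ Q? P? (λ x _ → from β x) (λ _ → from-∈ β) (to-injective (⇿-sym β)))

module _ {n k : ℕ} {P Q : Fin n → Set} (P? : Decidable P)
         (E : Enumeration P k) (F : Enumeration Q k) where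

  transfer : Fin n → Fin n
  transfer x with P? x
  ... | yes p = element F (index E x p)
  ... | no  _ = x

  transfer-∈ : ∀ {x} → P x → Q (transfer x)
  transfer-∈ {x} p with P? x
  ... | yes p′ = element-∈ F (index E x p′)
  ... | no  ¬p = contradiction p ¬p

transfer-transfer : ∀ {n k} {P Q : Fin n → Set} (P? : Decidable P) (Q? : Decidable Q)
                    (E : Enumeration P k) (F : Enumeration Q k) →
                    ∀ {x} → P x → transfer Q? F E (transfer P? E F x) ≡ x
transfer-transfer P? Q? E F {x} p with P? x
... | no  ¬p = contradiction p ¬p
... | yes p′ with Q? (element F (index E x p′))
...   | no  ¬q = contradiction (element-∈ F _) ¬q
...   | yes q  = trans (cong (element E) (element-injective F (element-index F _ q)))
                       (element-index E x p′)

-- The elements in equal positions of the two enumerations are matched.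
equinumerous⇒⇿ : ∀ {n k} {P Q : Fin n → Set} → Decidable P → Decidable Q →
                 Enumeration P k → Enumeration Q k → P ⇿ Q
equinumerous⇒⇿ P? Q? E F = record
  { to = transfer P? E F ; from = transfer Q? F E
  ; to-∈ = transfer-∈ P? E F ; from-∈ = transfer-∈ Q? F E
  ; from-to = transfer-transfer P? Q? E F ; to-from = transfer-transfer Q? P? F E }

-- Stated as a pigeonhole principle, so that it passes along partial bijections without counting and
-- directly identifies a third element with one of two known ones.
AtMostTwo : {A : Set} → (A → Set) → Set
AtMostTwo P = ∀ {x y z} → P x → P y → P z → x ≡ y ⊎ x ≡ z ⊎ y ≡ z

enumeration₂⇒AtMostTwo : ∀ {n} {P : Fin n → Set} → Enumeration P 2 → AtMostTwo P
enumeration₂⇒AtMostTwo E p q r =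
  Sum.map (index-injective E p q) (Sum.map (index-injective E p r) (index-injective E q r))
          (fin₂ (index E _ p) (index E _ q) (index E _ r))
  where
  fin₂ : (i j k : Fin 2) → i ≡ j ⊎ i ≡ k ⊎ j ≡ k
  fin₂ zero       zero       _          = inj₁ refl
  fin₂ zero       (suc _)    zero       = inj₂ (inj₁ refl)
  fin₂ zero       (suc zero) (suc zero) = inj₂ (inj₂ refl)
  fin₂ (suc _)    zero       zero       = inj₂ (inj₂ refl)
  fin₂ (suc zero) zero       (suc zero) = inj₂ (inj₁ refl)
  fin₂ (suc zero) (suc zero) _          = inj₁ refl

enumeration₃⇒¬AtMostTwo : ∀ {n k} {P : Fin n → Set} → 3 ≤ k → Enumeration P k → ¬ AtMostTwo P
enumeration₃⇒¬AtMostTwo (s≤s (s≤s (s≤s _))) E two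
  with two (element-∈ E zero) (element-∈ E (suc zero)) (element-∈ E (suc (suc zero)))
... | inj₁ eq        with () ← element-injective E eq
... | inj₂ (inj₁ eq) with () ← element-injective E eq
... | inj₂ (inj₂ eq) with () ← element-injective E eq

enumeration⇒∃ : ∀ {n k} {P : Fin n → Set} → 1 ≤ k → Enumeration P k → ∃[ x ] P x
enumeration⇒∃ (s≤s _) E = element E zero , element-∈ E zero

enumeration⇒∃₂ : ∀ {n k} {P : Fin n → Set} → 2 ≤ k → Enumeration P k →
                 ∃[ x ] ∃[ y ] (P x × P y × x ≢ y)
enumeration⇒∃₂ (s≤s (s≤s _)) E =
  element E zero , element E (suc zero) , element-∈ E _ , element-∈ E _ ,
  λ eq → Fin.0≢1+n (element-injective E eq)

another : ∀ {n k} {P : Fin n → Set} → 2 ≤ k → Enumeration P k → ∀ a → ∃[ b ] (P b × b ≢ a)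
another 2≤k E a with x , y , Px , Py , x≢y ← enumeration⇒∃₂ 2≤k E with x Fin.≟ a
... | no  x≢a  = x , Px , x≢a
... | yes refl = y , Py , ≢-sym x≢y

⇿-AtMostTwo : {A B : Set} {P : A → Set} {Q : B → Set} → P ⇿ Q → AtMostTwo Q → AtMostTwo P
⇿-AtMostTwo β two p q r =
  Sum.map (to-injective β p q) (Sum.map (to-injective β p r) (to-injective β q r))
          (two (to-∈ β p) (to-∈ β q) (to-∈ β r))

-- Isomorphisms and the neighbour form of star-transitivity

open SimpleGraph using (valency)

≅-sym : ∀ {G H} → G ≅ H → H ≅ G
≅-sym {G} {H} σ = record
  { bij      = mk↔ₛ′ σ.from σ.to σ.strictlyInverseʳ σ.strictlyInverseˡ
  ; preserve = λ u v → mk⇔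
      (λ u~v → Equivalence.from (_≅_.preserve σ _ _)
                 (subst₂ H._~_ (sym (σ.strictlyInverseˡ u)) (sym (σ.strictlyInverseˡ v)) u~v))
      (λ u~v → subst₂ H._~_ (σ.strictlyInverseˡ u) (σ.strictlyInverseˡ v)
                 (Equivalence.to (_≅_.preserve σ _ _) u~v))
  }
  where
  module G = SimpleGraph G
  module H = SimpleGraph H
  module σ = Inverse (_≅_.bij σ)

≅-trans : ∀ {G H K} → G ≅ H → H ≅ K → G ≅ K
≅-trans {G} {H} {K} σ τ = record
  { bij      = mk↔ₛ′ (τ.to ∘ σ.to) (σ.from ∘ τ.from)
      (λ x → trans (cong τ.to (σ.strictlyInverseˡ _)) (τ.strictlyInverseˡ x))
      (λ x → trans (cong σ.from (τ.strictlyInverseʳ _)) (σ.strictlyInverseʳ x))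
  ; preserve = λ u v → mk⇔
      (Equivalence.to (_≅_.preserve τ _ _) ∘ Equivalence.to (_≅_.preserve σ u v))
      (Equivalence.from (_≅_.preserve σ u v) ∘ Equivalence.from (_≅_.preserve τ _ _))
  }
  where
  module σ = Inverse (_≅_.bij σ)
  module τ = Inverse (_≅_.bij τ)

module _ {G H : SimpleGraph} (σ : G ≅ H) where
  private
    module G = SimpleGraph G
    module H = SimpleGraph H
    module σ = Inverse (_≅_.bij σ)

  image : G.Vertex → H.Vertex
  image = σ.to

  image-~ : ∀ {u v} → u G.~ v → image u H.~ image v
  image-~ = Equivalence.to (_≅_.preserve σ _ _)

  image-injective : ∀ {u v} → image u ≡ image v → u ≡ v
  image-injective eq =
    trans (sym (σ.strictlyInverseʳ _)) (trans (cong σ.from eq) (σ.strictlyInverseʳ _))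

  image-from : ∀ x → image (σ.from x) ≡ x
  image-from = σ.strictlyInverseˡ

  from-image : ∀ x → σ.from (image x) ≡ x
  from-image = σ.strictlyInverseʳ

image-⇿ : ∀ {G H} (σ : G ≅ H) v → (SimpleGraph._~_ G v) ⇿ (SimpleGraph._~_ H (image σ v))
image-⇿ {G} σ v = record
  { to = image σ ; from = image (≅-sym σ)
  ; to-∈    = image-~ σ
  ; from-∈  = λ p → subst (λ u → SimpleGraph._~_ G u _) (from-image σ v) (image-~ (≅-sym σ) p)
  ; from-to = λ _ → from-image σ _
  ; to-from = λ _ → image-from σ _
  }

module _ {G H : SimpleGraph} where
  private
    module G = SimpleGraph G
    module H = SimpleGraph H

  bijection⇒≅ : (h : G.Vertex → H.Vertex) →
                (∀ {u v} → h u ≡ h v → u ≡ v) → (∀ x → ∃[ u ] h u ≡ x) →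
                (∀ {u v} → u G.~ v → h u H.~ h v) → (∀ {u v} → h u H.~ h v → u G.~ v) →
                G ≅ H
  bijection⇒≅ h h-injective h-surjective preserves reflects = record
    { bij      = mk↔ₛ′ h (proj₁ ∘ h-surjective) (proj₂ ∘ h-surjective)
                   (λ u → h-injective (proj₂ (h-surjective (h u))))
    ; preserve = λ u v → mk⇔ preserves reflects
    }

NeighbourTransitive : SimpleGraph → Set
NeighbourTransitive G =
  ∀ v w (β : (v ~_) ⇿ (w ~_)) →
  ∃[ ψ ] (actVertex G ψ v ≡ w × (∀ {x} → v ~ x → actVertex G ψ x ≡ to β x))
  where open SimpleGraph G

-- Both `β` and the automorphism found for it are conjugated by `σ`.
NeighbourTransitive-≅ : ∀ {G H} → G ≅ H → NeighbourTransitive H → NeighbourTransitive G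
NeighbourTransitive-≅ {G} {H} σ nt v w β
  with ψ , ψv , ψN ← nt (image σ v) (image σ w)
                        (⇿-trans (⇿-sym (image-⇿ σ v)) (⇿-trans β (image-⇿ σ w))) =
  ≅-trans (≅-trans σ ψ) (≅-sym σ)
  , trans (cong (image (≅-sym σ)) ψv) (from-image σ w)
  , λ {x} v~x → trans (cong (image (≅-sym σ)) (ψN (image-~ σ v~x)))
                 (trans (from-image σ _) (cong (to β) (from-image σ x)))

LowEnds : SimpleGraph → Set
LowEnds G = ∀ {u v} → u ~ v → AtMostTwo (u ~_) ⊎ AtMostTwo (v ~_)
  where open SimpleGraph G

LowEnds-≅ : ∀ {G H} → G ≅ H → LowEnds H → LowEnds G
LowEnds-≅ σ low u~v = Sum.map (⇿-AtMostTwo (image-⇿ σ _)) (⇿-AtMostTwo (image-⇿ σ _))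
                              (low (image-~ σ u~v))

-- Edges as unordered pairs

module _ (G : SimpleGraph) where
  open SimpleGraph G

  ~⇒≢ : ∀ {u v} → u ~ v → u ≢ v
  ~⇒≢ u~v u≡v = ~-irrefl u≡v u~v

  ∈ₑ? : ∀ v → Decidable (λ e → _∈ₑ_ G v e)
  ∈ₑ? v e = (v Fin.≟ lo G e) ⊎-dec (v Fin.≟ hi G e)

  mkEdge-∈ : ∀ u v .(u~v : u ~ v) → _∈ₑ_ G u (mkEdge G u v u~v) × _∈ₑ_ G v (mkEdge G u v u~v)
  mkEdge-∈ u v u~v with Fin.<-cmp u v
  ... | tri< _ _ _   = inj₁ refl , inj₂ refl
  ... | tri≈ _ u≡v _ = contradiction (recompute (u ~? v) u~v) (~-irrefl u≡v)
  ... | tri> _ _ _   = inj₂ refl , inj₁ refl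

  ∈-mkEdge : ∀ u v .(u~v : u ~ v) {x} → _∈ₑ_ G x (mkEdge G u v u~v) → x ≡ u ⊎ x ≡ v
  ∈-mkEdge u v u~v p with Fin.<-cmp u v
  ... | tri< _ _ _   = p
  ... | tri≈ _ u≡v _ = contradiction (recompute (u ~? v) u~v) (~-irrefl u≡v)
  ... | tri> _ _ _   = Sum.swap p

  edge-unique : ∀ {x y e f} → x ≢ y → _∈ₑ_ G x e → _∈ₑ_ G y e → _∈ₑ_ G x f → _∈ₑ_ G y f → e ≡ f
  edge-unique {e = (a , b) , [ p ]} {f = (c , d) , [ q ]} x≢y = λ where
      (inj₁ refl) (inj₁ refl) _ _ → contradiction refl x≢y
      (inj₂ refl) (inj₂ refl) _ _ → contradiction refl x≢y
      _ _ (inj₁ refl) (inj₁ refl) → contradiction refl x≢y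
      _ _ (inj₂ refl) (inj₂ refl) → contradiction refl x≢y
      (inj₁ refl) (inj₂ refl) (inj₁ refl) (inj₂ refl) → refl
      (inj₂ refl) (inj₁ refl) (inj₂ refl) (inj₁ refl) → refl
      -- In the last two cases the edges would list the same pair in opposite orders, although each
      -- stores its smaller end first.
      (inj₁ refl) (inj₂ refl) (inj₂ refl) (inj₁ refl) → contradiction a<b (ℕ.<-asym c<d)
      (inj₂ refl) (inj₁ refl) (inj₁ refl) (inj₂ refl) → contradiction a<b (ℕ.<-asym c<d)
    where
    a<b = recompute (a Fin.<? b) (proj₁ p)
    c<d = recompute (c Fin.<? d) (proj₁ q)

  other : Vertex → Edge G → Vertex
  other v e with lo G e Fin.≟ v
  ... | yes _ = hi G e
  ... | no  _ = lo G e

  other-∈ : ∀ v e → _∈ₑ_ G (other v e) e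
  other-∈ v e with lo G e Fin.≟ v
  ... | yes _ = inj₂ refl
  ... | no  _ = inj₁ refl

  ~-other : ∀ v e → .(_∈ₑ_ G v e) → v ~ other v e
  ~-other v e@((a , b) , [ p ]) m with a Fin.≟ v | recompute (∈ₑ? v e) m
  ... | yes refl | _         = recompute (a ~? b) (proj₂ p)
  ... | no  a≢v  | inj₁ v≡a  = contradiction (sym v≡a) a≢v
  ... | no  _    | inj₂ refl = ~-sym (recompute (a ~? b) (proj₂ p))

  other-unique : ∀ {x y e} → x ≢ y → _∈ₑ_ G x e → _∈ₑ_ G y e → other x e ≡ y
  other-unique {x} {e = (a , b) , _} x≢y x∈e y∈e with a Fin.≟ x | x∈e | y∈e
  ... | yes refl | _         | inj₁ refl = contradiction refl x≢y
  ... | yes refl | _         | inj₂ refl = refl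
  ... | no  a≢x  | inj₁ refl | _         = contradiction refl a≢x
  ... | no  _    | inj₂ _    | inj₁ refl = refl
  ... | no  _    | inj₂ refl | inj₂ refl = contradiction refl x≢y

  actEdge-∈ : ∀ ψ {x} e → _∈ₑ_ G x e → _∈ₑ_ G (actVertex G ψ x) (actEdge G ψ e)
  actEdge-∈ ψ ((a , b) , [ p ]) (inj₁ refl) = proj₁ (mkEdge-∈ _ _ _)
  actEdge-∈ ψ ((a , b) , [ p ]) (inj₂ refl) = proj₂ (mkEdge-∈ (actVertex G ψ a) _ _)

  -- A predicate on cells rather than on edges: star isomorphisms act on cells and can then be
  -- restricted to it.
  EdgeAt : Vertex → Cell G → Set
  EdgeAt v = Incident G (vertex v)

  edgeTo : Vertex → Vertex → Cell G
  edgeTo v w with v ~? w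
  ... | yes v~w = edge (mkEdge G v w v~w)
  -- A default for non-neighbours of `v`, which lie outside the domain of the bijection below.
  ... | no  _   = vertex w

  edgeTo-~ : ∀ {v w} (v~w : v ~ w) → edgeTo v w ≡ edge (mkEdge G v w v~w)
  edgeTo-~ {v} {w} v~w with v ~? w
  ... | yes _   = refl
  ... | no  v≁w = contradiction v~w v≁w

  farEnd : Vertex → Cell G → Vertex
  farEnd v (vertex x) = x
  farEnd v (edge e)   = other v e

  -- In a simple graph an edge at `v` is determined by its far end. This dictionary translates
  -- bijections of stars into bijections of neighbourhoods and back.
  neighbours⇿edges : ∀ v → (v ~_) ⇿ EdgeAt v
  neighbours⇿edges v = record
    { to = edgeTo v ; from = farEnd v
    ; to-∈ = λ {w} p → subst (EdgeAt v) (sym (edgeTo-~ p)) (proj₁ (mkEdge-∈ v w p))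
    ; from-∈ = λ { {edge e} v∈e → ~-other v e v∈e }
    ; from-to = λ {w} p → trans (cong (farEnd v) (edgeTo-~ p))
        (other-unique (~⇒≢ p) (proj₁ (mkEdge-∈ v w p)) (proj₂ (mkEdge-∈ v w p)))
    ; to-from = λ { {edge e} v∈e → let v~o = ~-other v e v∈e in
        trans (edgeTo-~ v~o)
          (cong edge (edge-unique (~⇒≢ v~o) (proj₁ (mkEdge-∈ v _ v~o)) (proj₂ (mkEdge-∈ v _ v~o))
                                  v∈e (other-∈ v e))) }
    }

  onNeighbours : ∀ {v w} → EdgeAt v ⇿ EdgeAt w → (v ~_) ⇿ (w ~_)
  onNeighbours γ = ⇿-trans (neighbours⇿edges _) (⇿-trans γ (⇿-sym (neighbours⇿edges _)))

  -- An edge is determined by its two ends, and `ψ` sends those of `e` to `w` and to the far end of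
  -- the edge that `γ` assigns to `e`.
  act-edge : ∀ ψ {v w} (γ : EdgeAt v ⇿ EdgeAt w) → actVertex G ψ v ≡ w →
             (∀ {x} → v ~ x → actVertex G ψ x ≡ to (onNeighbours γ) x) →
             ∀ e → _∈ₑ_ G v e → act G ψ (edge e) ≡ to γ (edge e)
  act-edge ψ {v} γ refl ψN e v∈e with to γ (edge e) in γe | to-∈ γ {edge e} v∈e
  ... | edge f | w∈f = cong edge (edge-unique (λ eq → ~⇒≢ v~x (image-injective ψ eq))
                                    (actEdge-∈ ψ e v∈e) (actEdge-∈ ψ e (other-∈ v e))
                                    w∈f (subst (λ y → _∈ₑ_ G y f) (sym ψx) (other-∈ _ f)))
    where
    v~x = ~-other v e v∈e
    ψx : actVertex G ψ (other v e) ≡ other (actVertex G ψ v) f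
    ψx = trans (ψN v~x) (cong (farEnd _)
           (trans (cong (to γ) (to-from (neighbours⇿edges v) {edge e} v∈e)) γe))

-- From star-transitivity to neighbour-transitivity and back

  vertex-injective : ∀ {x y} → vertex {G} x ≡ vertex y → x ≡ y
  vertex-injective refl = refl

  edge-injective : ∀ {e f} → edge {G} e ≡ edge f → e ≡ f
  edge-injective refl = refl

  InStar? : ∀ v → Decidable (InStar G v)
  InStar? v (vertex w) = w Fin.≟ v
  InStar? v (edge e)   = ∈ₑ? v e

  InEdgeStar? : ∀ e → Decidable (InEdgeStar G e)
  InEdgeStar? e (vertex w) = ∈ₑ? w e
  InEdgeStar? e (edge f)   = ∈ₑ? (lo G e) f ⊎-dec ∈ₑ? (hi G e) f

  EdgeAt⇒InStar : ∀ {v} c → EdgeAt v c → InStar G v c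
  EdgeAt⇒InStar (edge _) p = p

  InStar⇒EdgeAt : ∀ {v c} → InStar G v c → c ≢ vertex v → EdgeAt v c
  InStar⇒EdgeAt {c = vertex _} refl c≢v = contradiction refl c≢v
  InStar⇒EdgeAt {c = edge _}   p    _   = p

  module _ {v w} (γ : EdgeAt v ⇿ EdgeAt w) where

    private
      toStar : ∀ {u} (f : Cell G → Cell G) → Cell G → Cell G
      -- The centre is the only vertex in an open star, so all vertex cells can be sent to the new
      -- centre `u`.
      toStar {u} f (vertex _) = vertex u
      toStar     f (edge e)   = f (edge e)

      toStar-edge : ∀ {u x} f c → EdgeAt x c → toStar {u} f c ≡ f c
      toStar-edge f (edge _) _ = refl

    withCentre : InStar G v ⇿ InStar G w
    withCentre = record
      { to      = toStar {w} (to γ)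
      ; from    = toStar {v} (from γ)
      ; to-∈    = λ { {vertex _} _ → refl ; {edge e} p → EdgeAt⇒InStar _ (to-∈ γ {edge e} p) }
      ; from-∈  = λ { {vertex _} _ → refl ; {edge e} p → EdgeAt⇒InStar _ (from-∈ γ {edge e} p) }
      ; from-to = λ { {vertex _} refl → refl
                    ; {edge e} p → trans (toStar-edge (from γ) _ (to-∈ γ {edge e} p)) (from-to γ p) }
      ; to-from = λ { {vertex _} refl → refl
                    ; {edge e} p → trans (toStar-edge (to γ) _ (from-∈ γ {edge e} p)) (to-from γ p) }
      }

  -- The bijection `β` is carried over to edges and completed by the centre to a star isomorphism.
  starTransitive⇒neighbourTransitive : StarTransitive G → NeighbourTransitive G
  starTransitive⇒neighbourTransitive st v w β = ψ , ψv≡w , ψN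
    where
    γ : EdgeAt v ⇿ EdgeAt w
    γ = ⇿-trans (⇿-sym (neighbours⇿edges v)) (⇿-trans β (neighbours⇿edges w))

    extension : ∃[ ψ ] ((c : Defs.st G v) → act G ψ (value c) ≡ to (withCentre γ) (value c))
    extension = st v w record
      { bij       = ⇿⇒↔ (InStar? v) (InStar? w) (withCentre γ)
      ; to-centre = refl }

    ψ = proj₁ extension

    ψv≡w : actVertex G ψ v ≡ w
    ψv≡w = vertex-injective (proj₂ extension (centre G v))

    ψN : ∀ {x} → v ~ x → actVertex G ψ x ≡ to β x
    ψN {x} v~x =
      -- The image of `x` is an end of the edge joining `w` to `to β x`; it is not `w`, which is
      -- already the image of `v`.
      [ (λ ψx≡w → contradiction (image-injective ψ (trans ψv≡w (sym ψx≡w))) (~⇒≢ v~x)) , id ]′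
        (∈-mkEdge w (to β x) (to-∈ β v~x) (subst (_∈ₑ_ G _) (edge-injective ψe) (actEdge-∈ ψ e x∈e)))
      where
      e   = mkEdge G v x v~x
      v∈e = proj₁ (mkEdge-∈ v x v~x)
      x∈e = proj₂ (mkEdge-∈ v x v~x)
      ψe : act G ψ (edge e) ≡ edge (mkEdge G w (to β x) (to-∈ β v~x))
      ψe = trans (proj₂ extension (edge e , [ v∈e ]))
             (trans (cong (edgeTo w ∘ to β) (other-unique (~⇒≢ v~x) v∈e x∈e))
                    (edgeTo-~ (to-∈ β v~x)))

  -- A star isomorphism sends centre to centre, so by injectivity it restricts to the edges at the
  -- two centres, hence to a bijection of neighbourhoods.
  neighbourTransitive⇒starTransitive : NeighbourTransitive G → StarTransitive G
  neighbourTransitive⇒starTransitive nt v w φ = ψ , acts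
    where
    δ : InStar G v ⇿ InStar G w
    δ = ↔⇒⇿ (InStar? v) (InStar? w) (StarIso.bij φ)

    δ-value : ∀ c → to δ (value c) ≡ value (StarIso.to φ c)
    δ-value = extend-∈ (InStar? v) (StarIso.to φ)

    δv≡w : to δ (vertex v) ≡ vertex w
    δv≡w = trans (δ-value (centre G v)) (cong value (StarIso.to-centre φ))

    δ-EdgeAt : ∀ {c} → EdgeAt v c → EdgeAt w (to δ c)
    δ-EdgeAt {edge e} p = InStar⇒EdgeAt (to-∈ δ {edge e} p) λ eq →
      edge≢vertex (to-injective δ {edge e} {vertex v} p refl (trans eq (sym δv≡w)))
      where
      edge≢vertex : edge e ≢ vertex v
      edge≢vertex ()

    δ⁻¹-EdgeAt : ∀ {c} → EdgeAt w c → EdgeAt v (from δ c)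
    δ⁻¹-EdgeAt {edge e} p = InStar⇒EdgeAt (from-∈ δ {edge e} p) λ eq →
      edge≢vertex (trans (sym (to-from δ {edge e} p)) (trans (cong (to δ) eq) δv≡w))
      where
      edge≢vertex : edge e ≢ vertex w
      edge≢vertex ()

    γ : EdgeAt v ⇿ EdgeAt w
    γ = ⇿-restrict δ (EdgeAt⇒InStar _) (EdgeAt⇒InStar _) δ-EdgeAt δ⁻¹-EdgeAt

    solution = nt v w (onNeighbours γ)
    ψ        = proj₁ solution
    ψv≡w     = proj₁ (proj₂ solution)

    acts : (c : Defs.st G v) → act G ψ (value c) ≡ value (StarIso.to φ c)
    acts c@(vertex x , [ p ]) with refl ← recompute (x Fin.≟ v) p =
      trans (cong vertex ψv≡w) (trans (sym δv≡w) (δ-value c))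
    acts c@(edge e , [ p ]) =
      trans (act-edge ψ γ ψv≡w (proj₂ (proj₂ solution)) e (recompute (∈ₑ? v e) p)) (δ-value c)

  -- If v₁ has at most two neighbours, the action on its neighbours is forced by u₁ ↦ u₂.
  extend-both : NeighbourTransitive G → ∀ {u₁ v₁ u₂ v₂} → u₁ ~ v₁ →
                (β : (u₁ ~_) ⇿ (u₂ ~_)) (γ : (v₁ ~_) ⇿ (v₂ ~_)) →
                to β v₁ ≡ v₂ → to γ u₁ ≡ u₂ → AtMostTwo (v₁ ~_) →
                ∃[ ψ ] (actVertex G ψ u₁ ≡ u₂ × (∀ {x} → u₁ ~ x → actVertex G ψ x ≡ to β x)
                      × actVertex G ψ v₁ ≡ v₂ × (∀ {x} → v₁ ~ x → actVertex G ψ x ≡ to γ x))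
  extend-both nt {u₁} {v₁} {u₂} {v₂} u~v β γ βv γu two with ψ , ψu , ψβ ← nt u₁ u₂ β =
    ψ , ψu , ψβ , ψv , ψγ
    where
    ψv : actVertex G ψ v₁ ≡ v₂
    ψv = trans (ψβ u~v) βv

    two′ : AtMostTwo (v₂ ~_)
    two′ = ⇿-AtMostTwo (⇿-sym γ) two

    ψγ : ∀ {x} → v₁ ~ x → actVertex G ψ x ≡ to γ x
    ψγ {x} v~x with x Fin.≟ u₁
    ... | yes refl = trans ψu (sym γu)
    -- Among the neighbours of `v₂`, both candidates for the image of `x` differ from `u₂`, the
    -- image of `u₁`, and so they coincide.
    ... | no x≢u with two′ (subst (v₂ ~_) γu (to-∈ γ (~-sym u~v)))
                           (subst (_~ _) ψv (image-~ ψ v~x)) (to-∈ γ v~x)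
    ...   | inj₁ u≡ψx        = contradiction (image-injective ψ (trans (sym u≡ψx) (sym ψu))) x≢u
    ...   | inj₂ (inj₁ u≡γx) =
      contradiction (to-injective γ v~x (~-sym u~v) (trans (sym u≡γx) (sym γu))) x≢u
    ...   | inj₂ (inj₂ eq)   = eq

  -- Extending edge-star isomorphisms

  lo~hi : ∀ e → lo G e ~ hi G e
  lo~hi ((a , b) , [ p ]) = recompute (a ~? b) (proj₂ p)

  -- The ends of `e₂` are named `u₂` and `v₂` instead of `lo` and `hi`, so that one argument covers
  -- both orders in which `φ` may map the ends.
  module _ (nt : NeighbourTransitive G) (low : LowEnds G) {e₁ e₂} (φ : EdgeStarIso G e₁ e₂)
           {u₂ v₂} (lo↦u₂ : value (EdgeStarIso.to φ (loEnd G e₁)) ≡ vertex u₂)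
           (hi↦v₂ : value (EdgeStarIso.to φ (hiEnd G e₁)) ≡ vertex v₂)
           (u₂-star : ∀ f → _∈ₑ_ G u₂ f → InEdgeStar G e₂ (edge f))
           (v₂-star : ∀ f → _∈ₑ_ G v₂ f → InEdgeStar G e₂ (edge f))
           (u₂≢v₂ : u₂ ≢ v₂) where

    private
      u₁ = lo G e₁
      v₁ = hi G e₁
      u~v = lo~hi e₁

      δ : InEdgeStar G e₁ ⇿ InEdgeStar G e₂
      δ = ↔⇒⇿ (InEdgeStar? e₁) (InEdgeStar? e₂) (EdgeStarIso.bij φ)

      δ-value : ∀ c → to δ (value c) ≡ value (EdgeStarIso.to φ c)
      δ-value = extend-∈ (InEdgeStar? e₁) (EdgeStarIso.to φ)

      -- The incidence condition at one end says exactly that `δ` matches the edges at that end with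
      -- the edges at its image.
      atEnd : ∀ {x y z} → value (EdgeStarIso.to φ z) ≡ vertex y →
              (∀ c → EdgeAt x (value c)
                   ⇔ Incident G (value (EdgeStarIso.to φ z)) (value (EdgeStarIso.to φ c))) →
              (∀ f → _∈ₑ_ G x f → InEdgeStar G e₁ (edge f)) →
              (∀ f → _∈ₑ_ G y f → InEdgeStar G e₂ (edge f)) →
              EdgeAt x ⇿ EdgeAt y
      atEnd {x} {y} z↦y incident x-star y-star = ⇿-restrict δ
        (λ { {edge f} p → x-star f p }) (λ { {edge f} p → y-star f p })
        (λ { {edge f} p → subst₂ (Incident G) z↦y (sym (δ-value (edge f , [ x-star f p ])))
               (Equivalence.to (incident (edge f , [ x-star f p ])) p) })
        (λ { {edge f} p → let q = from-∈ δ {edge f} (y-star f p) in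
               Equivalence.from (incident (from δ (edge f) , [ q ]))
                 (subst₂ (Incident G) (sym z↦y)
                   (trans (sym (to-from δ {edge f} (y-star f p))) (δ-value (_ , [ q ]))) p) })

      βₑ : EdgeAt u₁ ⇿ EdgeAt u₂
      βₑ = atEnd lo↦u₂ (EdgeStarIso.incident-lo φ) (λ _ → inj₁) u₂-star

      γₑ : EdgeAt v₁ ⇿ EdgeAt v₂
      γₑ = atEnd hi↦v₂ (EdgeStarIso.incident-hi φ) (λ _ → inj₂) v₂-star

      β = onNeighbours βₑ
      γ = onNeighbours γₑ

      farEnd-δ : ∀ {x y} c → EdgeAt x c → EdgeAt y c → x ≢ y → farEnd x c ≡ y
      farEnd-δ (edge f) p q x≢y = other-unique x≢y p q

      edgeTo-ends : ∀ {x y} → x ~ y → _∈ₑ_ G x e₁ → _∈ₑ_ G y e₁ → edgeTo x y ≡ edge e₁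
      edgeTo-ends {x} {y} x~y p q = trans (edgeTo-~ x~y)
        (cong edge (edge-unique (~⇒≢ x~y) (proj₁ (mkEdge-∈ x y x~y)) (proj₂ (mkEdge-∈ x y x~y)) p q))

      δe₁∈u₂ : EdgeAt u₂ (to δ (edge e₁))
      δe₁∈u₂ = to-∈ βₑ {edge e₁} (inj₁ refl)

      δe₁∈v₂ : EdgeAt v₂ (to δ (edge e₁))
      δe₁∈v₂ = to-∈ γₑ {edge e₁} (inj₂ refl)

      -- `δ` sends `e₁` to an edge through both `u₂` and `v₂`, whose end opposite to `u₂` is
      -- therefore `v₂`. This makes `β` and `γ` compatible along the edge.
      βv : to β v₁ ≡ v₂
      βv = trans (cong (farEnd u₂ ∘ to δ) (edgeTo-ends u~v (inj₁ refl) (inj₂ refl)))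
                 (farEnd-δ _ δe₁∈u₂ δe₁∈v₂ u₂≢v₂)

      γu : to γ u₁ ≡ u₂
      γu = trans (cong (farEnd v₂ ∘ to δ) (edgeTo-ends (~-sym u~v) (inj₂ refl) (inj₁ refl)))
                 (farEnd-δ _ δe₁∈v₂ δe₁∈u₂ (≢-sym u₂≢v₂))

      extension : ∃[ ψ ] (actVertex G ψ u₁ ≡ u₂ × (∀ {x} → u₁ ~ x → actVertex G ψ x ≡ to β x)
                        × actVertex G ψ v₁ ≡ v₂ × (∀ {x} → v₁ ~ x → actVertex G ψ x ≡ to γ x))
      extension with low u~v
      ... | inj₂ two = extend-both nt u~v β γ βv γu two
      -- When the end with at most two neighbours is `u₁`, the automorphism is built from `v₁`
      -- instead.
      ... | inj₁ two with ψ , ψv , ψγ , ψu , ψβ ← extend-both nt (~-sym u~v) γ β γu βv two =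
        ψ , ψu , ψβ , ψv , ψγ

    edgeStarIso-extends : ∃[ ψ ] ((c : stₑ G e₁) → act G ψ (value c) ≡ value (EdgeStarIso.to φ c))
    edgeStarIso-extends with ψ , ψu , ψβ , ψv , ψγ ← extension =
      ψ , λ { c@(_ , [ p ]) → trans (acts (value c) (recompute (InEdgeStar? e₁ _) p)) (δ-value c) }
      where
      acts : ∀ c → InEdgeStar G e₁ c → act G ψ c ≡ to δ c
      acts (vertex _) (inj₁ refl) = trans (cong vertex ψu) (sym (trans (δ-value (loEnd G e₁)) lo↦u₂))
      acts (vertex _) (inj₂ refl) = trans (cong vertex ψv) (sym (trans (δ-value (hiEnd G e₁)) hi↦v₂))
      acts (edge f)   (inj₁ u∈f)  = act-edge ψ βₑ ψu ψβ f u∈f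
      acts (edge f)   (inj₂ v∈f)  = act-edge ψ γₑ ψv ψγ f v∈f

  neighbourTransitive⇒stEdgeTransitive : NeighbourTransitive G → LowEnds G → StEdgeTransitive G
  neighbourTransitive⇒stEdgeTransitive nt low e₁ e₂ φ with EdgeStarIso.to-ends φ
  ... | inj₁ (l , h) = edgeStarIso-extends nt low φ (cong value l) (cong value h) (λ _ → inj₁) (λ _ → inj₂)
                         (~⇒≢ (lo~hi e₂))
  ... | inj₂ (l , h) = edgeStarIso-extends nt low φ (cong value l) (cong value h) (λ _ → inj₂) (λ _ → inj₁)
                         (≢-sym (~⇒≢ (lo~hi e₂)))

-- Stars

IsStar : (G : SimpleGraph) → SimpleGraph.Vertex G → Set
IsStar G c = (∀ {v} → v ≢ c → c ~ v) × (∀ {u v} → u ~ v → u ≡ c ⊎ v ≡ c)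
  where open SimpleGraph G

-- The centre must become vertex `zero`, which is alone on its side of `CompleteBipartite 1 n`;
-- `punchIn` lists the remaining vertices after it.
startingAt : ∀ {N} (a : Fin N) → ∃[ n ] Σ[ h ∈ (Fin (suc n) → Fin N) ]
             (h zero ≡ a × (∀ {i j} → h i ≡ h j → i ≡ j) × (∀ x → ∃[ i ] h i ≡ x))
startingAt {suc n} a = n , h , refl , h-injective , h-surjective
  where
  h : Fin (suc n) → Fin (suc n)
  h zero    = a
  h (suc i) = Fin.punchIn a i

  h-injective : ∀ {i j} → h i ≡ h j → i ≡ j
  h-injective {zero}  {zero}  _  = refl
  h-injective {zero}  {suc j} eq = contradiction (sym eq) (Fin.punchInᵢ≢i a j)
  h-injective {suc i} {zero}  eq = contradiction eq (Fin.punchInᵢ≢i a i)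
  h-injective {suc i} {suc j} eq = cong suc (Fin.punchIn-injective a i j eq)

  h-surjective : ∀ x → ∃[ i ] h i ≡ x
  h-surjective x with a Fin.≟ x
  ... | yes a≡x = zero , a≡x
  ... | no  a≢x = suc (Fin.punchOut a≢x) , Fin.punchIn-punchOut a≢x

isStar⇒≅ : ∀ G {c} → IsStar G c → ∀ b → b ≢ c → ∃[ n ] (n ≥ 1 × G ≅ CompleteBipartite 1 n)
isStar⇒≅ G {c} (all , only) b b≢c with startingAt c
... | n , h , refl , h-injective , h-surjective =
  n
  , n≥1 (proj₁ (h-surjective b)) (λ eq → b≢c (trans (sym (proj₂ (h-surjective b))) (cong h eq)))
  , ≅-sym (bijection⇒≅ {CompleteBipartite 1 n} {G} h h-injective h-surjective
      (λ {u} {v} → preserves u v) (λ {u} {v} → reflects u v))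
  where
  open SimpleGraph G
  module K = SimpleGraph (CompleteBipartite 1 n)

  n≥1 : ∀ {m} (i : Fin (suc m)) → i ≢ zero → m ≥ 1
  n≥1 {zero}  zero i≢0 = contradiction refl i≢0
  n≥1 {suc m} _    _   = s≤s z≤n

  preserves : ∀ u v → u K.~ v → h u ~ h v
  preserves zero    zero    u≁v = contradiction refl u≁v
  preserves zero    (suc v) _   = all (Fin.0≢1+n ∘ sym ∘ h-injective)
  preserves (suc u) zero    _   = ~-sym (all (Fin.0≢1+n ∘ sym ∘ h-injective))
  preserves (suc u) (suc v) u≁v = contradiction refl u≁v

  reflects : ∀ u v → h u ~ h v → u K.~ v
  reflects zero    zero    u~v _ = ~-irrefl refl u~v
  reflects zero    (suc v) _   ()
  reflects (suc u) zero    _   ()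
  reflects (suc u) (suc v) u~v _ with only u~v
  ... | inj₁ eq with () ← h-injective eq
  ... | inj₂ eq with () ← h-injective eq

completeBipartite-isStar : ∀ n → IsStar (CompleteBipartite 1 n) zero
completeBipartite-isStar n = all , λ {u} {v} → only u v
  where
  open SimpleGraph (CompleteBipartite 1 n)
  all : ∀ {v} → v ≢ zero → zero ~ v
  all {zero}  v≢0 = contradiction refl v≢0
  all {suc v} _   ()
  only : ∀ u v → u ~ v → u ≡ zero ⊎ v ≡ zero
  only zero    _       _   = inj₁ refl
  only (suc u) zero    _   = inj₂ refl
  only (suc u) (suc v) u≁v = contradiction refl u≁v

module _ (G : SimpleGraph) {c} (star : IsStar G c) where
  open SimpleGraph G

  private
    all  = proj₁ star
    only = proj₂ star

    only-c : ∀ {v x} → v ≢ c → v ~ x → x ≡ c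
    only-c v≢c v~x = [ (λ v≡c → contradiction v≡c v≢c) , id ]′ (only v~x)

    ~⇒≢c : ∀ {v} → c ~ v → v ≢ c
    ~⇒≢c = ≢-sym ∘ ~⇒≢ G

  isStar-lowEnds : LowEnds G
  isStar-lowEnds {u} {v} u~v with u Fin.≟ c
  ... | no  u≢c  = inj₁ λ p q _ → inj₁ (trans (only-c u≢c p) (sym (only-c u≢c q)))
  ... | yes refl = inj₂ λ p q _ → inj₁ (trans (only-c (~⇒≢c u~v) p) (sym (only-c (~⇒≢c u~v) q)))

  -- Two vertices of a star are adjacent exactly when one is `c` and the other is not, so fixing `c`
  -- suffices for a permutation to be an automorphism.
  permutation⇒Aut : (h : Vertex → Vertex) → (∀ {u v} → h u ≡ h v → u ≡ v) →
                    (∀ x → ∃[ u ] h u ≡ x) → h c ≡ c → Aut G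
  permutation⇒Aut h h-injective h-surjective hc =
    bijection⇒≅ {G} {G} h h-injective h-surjective preserves reflects
    where
    preserves : ∀ {u v} → u ~ v → h u ~ h v
    preserves u~v with only u~v
    ... | inj₁ refl = subst (_~ _) (sym hc) (all λ eq → ~⇒≢c u~v (h-injective (trans eq (sym hc))))
    ... | inj₂ refl = subst (_ ~_) (sym hc)
                        (~-sym (all λ eq → ~⇒≢c (~-sym u~v) (h-injective (trans eq (sym hc)))))
    reflects : ∀ {u v} → h u ~ h v → u ~ v
    reflects {u} {v} u~v with only u~v
    ... | inj₁ hu≡c with refl ← h-injective (trans hu≡c (sym hc)) =
      all λ { refl → ~-irrefl refl u~v }
    ... | inj₂ hv≡c with refl ← h-injective (trans hv≡c (sym hc)) =
      ~-sym (all λ { refl → ~-irrefl refl u~v })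

  -- A bijection of the leaves has an arbitrary value at `c`; this value is overridden to obtain a
  -- permutation of all vertices.
  fixing-c : (Vertex → Vertex) → Vertex → Vertex
  fixing-c f x with x Fin.≟ c
  ... | yes _ = c
  ... | no  _ = f x

  fixing-c-c : ∀ f → fixing-c f c ≡ c
  fixing-c-c f with c Fin.≟ c
  ... | yes _   = refl
  ... | no  c≢c = contradiction refl c≢c

  fixing-c-≢ : ∀ f {x} → x ≢ c → fixing-c f x ≡ f x
  fixing-c-≢ f {x} x≢c with x Fin.≟ c
  ... | yes x≡c = contradiction x≡c x≢c
  ... | no  _   = refl

  fixing-c-inverse : ∀ (β : (c ~_) ⇿ (c ~_)) x → fixing-c (from β) (fixing-c (to β) x) ≡ x
  fixing-c-inverse β x with x Fin.≟ c
  ... | yes refl = fixing-c-c (from β)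
  ... | no  x≢c  = trans (fixing-c-≢ (from β) (~⇒≢c (to-∈ β (all x≢c)))) (from-to β (all x≢c))

  private
    Extension : ∀ {v w} → (v ~_) ⇿ (w ~_) → Set
    Extension {v} {w} β = ∃[ ψ ] (actVertex G ψ v ≡ w × (∀ {x} → v ~ x → actVertex G ψ x ≡ to β x))

    centre→centre : (β : (c ~_) ⇿ (c ~_)) → Extension β
    centre→centre β =
      permutation⇒Aut (fixing-c (to β))
        (λ eq → trans (sym (fixing-c-inverse β _))
                  (trans (cong (fixing-c (from β)) eq) (fixing-c-inverse β _)))
        (λ x → fixing-c (from β) x , fixing-c-inverse (⇿-sym β) x)
        (fixing-c-c (to β))
      , fixing-c-c (to β)
      , λ c~x → fixing-c-≢ (to β) (~⇒≢c c~x)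

    -- The only neighbour of either leaf is `c`, so exchanging the two leaves realises every `β`.
    leaf→leaf : ∀ {v w} → v ≢ c → w ≢ c → (β : (v ~_) ⇿ (w ~_)) → Extension β
    leaf→leaf {v} {w} v≢c w≢c β =
      permutation⇒Aut (swap v w) swap-injective (λ x → swap v w x , swap-involutive v w x)
        (swap-other (≢-sym v≢c) (≢-sym w≢c))
      , swap-left v w
      , λ v~x → trans (cong (swap v w) (only-c v≢c v~x))
                  (trans (swap-other (≢-sym v≢c) (≢-sym w≢c)) (sym (only-c w≢c (to-∈ β v~x))))
      where
      swap-injective : ∀ {x y} → swap v w x ≡ swap v w y → x ≡ y
      swap-injective eq = trans (sym (swap-involutive v w _))
                            (trans (cong (swap v w) eq) (swap-involutive v w _))

    -- Here c has as many neighbours as a leaf, so w is its only one.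
    centre→leaf : ∀ {w} → w ≢ c → (β : (c ~_) ⇿ (w ~_)) → Extension β
    centre→leaf {w} w≢c β =
      bijection⇒≅ {G} {G} σ (λ eq → trans (sym (σσ _)) (trans (cong σ eq) (σσ _))) (λ x → σ x , σσ x)
        σ-~ (λ p → subst₂ _~_ (σσ _) (σσ _) (σ-~ p))
      , swap-left c w
      , λ c~x → trans (cong σ (only-w (~⇒≢c c~x)))
                  (trans (swap-right c w) (sym (only-c w≢c (to-∈ β c~x))))
      where
      σ  = swap c w
      σσ = swap-involutive c w

      only-w : ∀ {x} → x ≢ c → x ≡ w
      only-w x≢c = to-injective β (all x≢c) (all w≢c)
        (trans (only-c w≢c (to-∈ β (all x≢c))) (sym (only-c w≢c (to-∈ β (all w≢c)))))

      w~c : σ c ~ σ w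
      w~c = subst₂ _~_ (sym (swap-left c w)) (sym (swap-right c w)) (~-sym (all w≢c))

      σ-~ : ∀ {u v} → u ~ v → σ u ~ σ v
      σ-~ u~v with only u~v
      ... | inj₁ refl with refl ← only-w (~⇒≢c u~v) = w~c
      ... | inj₂ refl with refl ← only-w (~⇒≢c (~-sym u~v)) = ~-sym w~c

    inverse : ∀ {v w} (β : (v ~_) ⇿ (w ~_)) → Extension (⇿-sym β) → Extension β
    inverse β (ψ , ψw , ψN) =
      ≅-sym ψ
      , trans (cong (image (≅-sym ψ)) (sym ψw)) (from-image ψ _)
      , λ {x} v~x → trans (cong (image (≅-sym ψ)) (sym (trans (ψN (to-∈ β v~x)) (from-to β v~x))))
                      (from-image ψ _)

  isStar-neighbourTransitive : NeighbourTransitive G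
  isStar-neighbourTransitive v w β with v Fin.≟ c | w Fin.≟ c
  ... | yes refl | yes refl = centre→centre β
  ... | no  v≢c  | no  w≢c  = leaf→leaf v≢c w≢c β
  ... | yes refl | no  w≢c  = centre→leaf w≢c β
  ... | no  v≢c  | yes refl = inverse β (centre→leaf v≢c (⇿-sym β))

-- Valencies in a neighbour-transitive graph

-- The transposition of `x` and `y` is a bijection of the neighbourhood of `v`; the automorphism
-- extending it maps `x` to `y`.
neighbours-valency : ∀ G → NeighbourTransitive G →
                     ∀ {v x y} → SimpleGraph._~_ G v x → SimpleGraph._~_ G v y →
                     valency G x ≡ valency G y
neighbours-valency G nt {v} {x} {y} v~x v~y with ψ , _ , ψN ← nt v v (swap-⇿ v~x v~y) =
  trans (⇿⇒count-≡ (x ~?_) (image ψ x ~?_) (image-⇿ ψ x))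
        (cong (valency G) (trans (ψN v~x) (swap-left x y)))
  where open SimpleGraph G using (_~?_)

-- The valencies of the neighbours are recorded along with that of `x`, so that the property can be
-- passed across an edge.
BivalentAt : (G : SimpleGraph) → ℕ → SimpleGraph.Vertex G → Set
BivalentAt G k x = (valency G x ≡ 2 × (∀ {y} → x ~ y → valency G y ≡ k))
                 ⊎ (valency G x ≡ k × (∀ {y} → x ~ y → valency G y ≡ 2))
  where open SimpleGraph G using (_~_)

Bivalent : SimpleGraph → ℕ → Set
Bivalent G k = ∀ x → BivalentAt G k x

module _ (G : SimpleGraph) (connected : Connected G) (nt : NeighbourTransitive G) where
  open SimpleGraph G using (_~_; _~?_; ~-sym; ~-irrefl)

  -- All neighbours of `a` have valency one, as `v` has. A path from `a` can thus only step to a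
  -- leaf and back, and by connectedness nothing else exists.
  leaf⇒star : (∃[ v ] valency G v ≡ 1) → ∃[ n ] (n ≥ 1 × G ≅ CompleteBipartite 1 n)
  leaf⇒star (v , v₁) = isStar⇒≅ G isStar v (≢-sym (~⇒≢ G a~v))
    where
    leaf-unique : ∀ {u x y} → valency G u ≡ 1 → u ~ x → u ~ y → x ≡ y
    leaf-unique u₁ p q = index-injective E p q (fin₁ _ _)
      where
      E = enumerate-≡ (_ ~?_) u₁
      fin₁ : (i j : Fin 1) → i ≡ j
      fin₁ zero zero = refl

    a = proj₁ (enumeration⇒∃ (s≤s z≤n) (enumerate-≡ (v ~?_) v₁))

    v~a = proj₂ (enumeration⇒∃ (s≤s z≤n) (enumerate-≡ (v ~?_) v₁))

    a~v = ~-sym v~a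

    leaf : ∀ {x} → a ~ x → valency G x ≡ 1
    leaf a~x = trans (neighbours-valency G nt a~x a~v) v₁

    near : ∀ {x y} → Star _~_ x y → x ≡ a ⊎ a ~ x → y ≡ a ⊎ a ~ y
    near ε p = p
    near (x~y ◅ path) (inj₁ refl) = near path (inj₂ x~y)
    near (x~y ◅ path) (inj₂ a~x)  = near path (inj₁ (leaf-unique (leaf a~x) x~y (~-sym a~x)))

    reach : ∀ x → x ≡ a ⊎ a ~ x
    reach x = near (connected a x) (inj₁ refl)

    isStar : IsStar G a
    isStar = (λ {x} x≢a → [ (λ x≡a → contradiction x≡a x≢a) , id ]′ (reach x))
           , λ {x} {y} x~y → Sum.map₂ (λ a~x → leaf-unique (leaf a~x) x~y (~-sym a~x)) (reach x)

  neighbourTransitive⇒bivalent : ∀ {v} → valency G v ≡ 2 →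
                                 ∃[ k ] ((∃[ u ] valency G u ≡ k) × Bivalent G k)
  neighbourTransitive⇒bivalent {v} v₂ with a , v~a ← enumeration⇒∃ (s≤s z≤n) (enumerate-≡ (v ~?_) v₂) =
    valency G a , (a , refl) ,
    λ x → along (connected v x) (inj₁ (v₂ , λ v~y → neighbours-valency G nt v~y v~a))
    where
    along : ∀ {k x y} → Star _~_ x y → BivalentAt G k x → BivalentAt G k y
    along ε b = b
    along (x~y ◅ path) b = along path (step x~y b)
      where
      step : ∀ {k x y} → x ~ y → BivalentAt G k x → BivalentAt G k y
      -- As `x` is a neighbour of `y`, all neighbours of `y` share the valency of `x`.
      step x~y (inj₁ (x₂ , N)) = inj₂ (N x~y , λ y~z → trans (neighbours-valency G nt y~z (~-sym x~y)) x₂)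
      step x~y (inj₂ (xₖ , N)) = inj₁ (N x~y , λ y~z → trans (neighbours-valency G nt y~z (~-sym x~y)) xₖ)

-- Cycles

least : {Q : ℕ → Set} → Decidable Q → ∀ {n} → Q n → ∃[ m ] (Q m × (∀ {j} → j < m → ¬ Q j))
least {Q} Q? {n} Qn = [ id , (λ none → contradiction Qn (none ℕ.≤-refl)) ]′ (search (suc n))
  where
  search : ∀ n → (∃[ m ] (Q m × (∀ {j} → j < m → ¬ Q j))) ⊎ (∀ {j} → j < n → ¬ Q j)
  search zero = inj₂ λ ()
  search (suc n) with search n
  ... | inj₁ found = inj₁ found
  ... | inj₂ none with Q? n
  ...   | yes Qn = inj₁ (n , Qn , none)
  ...   | no ¬Qn = inj₂ λ j<1+n Qj → [ (λ j<n → none j<n Qj) , (λ { refl → ¬Qn Qj }) ]′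
                                       (ℕ.m<1+n⇒m<n∨m≡n j<1+n)

-- The second half is the form that walks use: whatever vertex `a` the walk came from, it can leave
-- `v` without returning there.
TwoRegular : SimpleGraph → Set
TwoRegular G = ∀ v → AtMostTwo (v ~_) × (∀ a → ∃[ b ] (v ~ b × b ≢ a))
  where open SimpleGraph G

TwoRegular-≅ : ∀ {G H} → G ≅ H → TwoRegular H → TwoRegular G
TwoRegular-≅ {G} {H} σ reg v =
  ⇿-AtMostTwo (image-⇿ σ v) (proj₁ (reg (image σ v))) ,
  λ a → let b , v~b , b≢a = proj₂ (reg (image σ v)) (image σ a) in
    from (image-⇿ σ v) b , from-∈ (image-⇿ σ v) v~b ,
    λ eq → b≢a (trans (sym (image-from σ b)) (cong (image σ) eq))

module _ (G : SimpleGraph) (connected : Connected G) (regular : TwoRegular G) where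
  open SimpleGraph G

  -- Following a walk that never turns back, the first vertex to be repeated is the initial one.
  module Walk {a b : Vertex} (a~b : a ~ b) where

    -- The walk carries two consecutive vertices, since each step has to avoid the vertex just left.
    arc : ℕ → Vertex × Vertex
    arc zero    = a , b
    arc (suc n) = let u , v = arc n in v , proj₁ (proj₂ (regular v) u)

    walk : ℕ → Vertex
    walk = proj₁ ∘ arc

    walk-~ : ∀ n → walk n ~ walk (suc n)
    walk-~ zero    = a~b
    walk-~ (suc n) = proj₁ (proj₂ (proj₂ (regular (walk (suc n))) (walk n)))

    no-return : ∀ n → walk (suc (suc n)) ≢ walk n
    no-return n = proj₂ (proj₂ (proj₂ (regular (walk (suc n))) (walk n)))

    ~-walk : ∀ n {y} → walk (suc n) ~ y → y ≡ walk n ⊎ y ≡ walk (suc (suc n))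
    ~-walk n y~ with proj₁ (regular (walk (suc n))) (~-sym (walk-~ n)) (walk-~ (suc n)) y~
    ... | inj₁ eq        = contradiction (sym eq) (no-return n)
    ... | inj₂ (inj₁ eq) = inj₁ (sym eq)
    ... | inj₂ (inj₂ eq) = inj₂ (sym eq)

    Repeated : ℕ → Set
    Repeated n = ∃[ j ] (j < n × walk j ≡ walk n)

    repetition : ∃[ n ] Repeated n
    repetition with i , j , i<j , eq ← Fin.pigeonhole (ℕ.n<1+n order) (walk ∘ toℕ) =
      toℕ j , toℕ i , i<j , eq

    private
      abstract
        firstRepetition : ∃[ n ] (Repeated n × (∀ {m} → m < n → ¬ Repeated m))
        firstRepetition = least (λ n → ℕ.anyUpTo? (λ j → walk j Fin.≟ walk n) n) (proj₂ repetition)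

    length : ℕ
    length = proj₁ firstRepetition

    not-repeated : ∀ {n} → n < length → ¬ Repeated n
    not-repeated = proj₂ (proj₂ firstRepetition)

    walk-injective : ∀ {i j} → i < length → j < length → walk i ≡ walk j → i ≡ j
    walk-injective {i} {j} i<n j<n eq with ℕ.<-cmp i j
    ... | tri< i<j _ _ = contradiction (i , i<j , eq) (not-repeated j<n)
    ... | tri≈ _ i≡j _ = i≡j
    ... | tri> _ _ j<i = contradiction (j , j<i , sym eq) (not-repeated i<n)

    -- Suppose the repeated vertex sits at a positive position `j`. Its predecessor at the second
    -- visit is a neighbour of it, hence the vertex before or after position `j`. That gives an
    -- earlier repetition, a loop or a turn back. For `j` zero, lengths one and two would again mean
    -- a loop or a turn back.
    returns-to-start : ∀ {n j} → j < n → walk j ≡ walk n → (∀ {m} → m < n → ¬ Repeated m) →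
                       walk n ≡ a × n ≥ 3
    returns-to-start {suc zero}       {zero} _ eq _ = contradiction (walk-~ 0) (~-irrefl eq)
    returns-to-start {suc (suc zero)} {zero} _ eq _ = contradiction (sym eq) (no-return 0)
    returns-to-start {suc (suc (suc n))} {zero} _ eq _ = sym eq , s≤s (s≤s (s≤s z≤n))
    returns-to-start {suc n} {suc j} (s≤s j<n) eq fresh
      with ~-walk j (~-sym (subst (walk n ~_) (sym eq) (walk-~ n)))
    ... | inj₁ eq′ = contradiction (j , j<n , sym eq′) (fresh ℕ.≤-refl)
    ... | inj₂ eq′ with ℕ.m≤n⇒m<n∨m≡n j<n
    ...   | inj₂ refl = contradiction (walk-~ (suc j)) (~-irrefl eq)
    ...   | inj₁ 1+j<n with ℕ.m≤n⇒m<n∨m≡n 1+j<n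
    ...     | inj₂ refl  = contradiction (sym eq) (no-return (suc j))
    ...     | inj₁ 2+j<n = contradiction (suc (suc j) , 2+j<n , sym eq′) (fresh ℕ.≤-refl)

    private
      returned : walk length ≡ a × length ≥ 3
      returned with _ , (_ , j<n , eq) , fresh ← firstRepetition = returns-to-start j<n eq fresh

    closed : walk length ≡ a
    closed = proj₁ returned

    length≥3 : length ≥ 3
    length≥3 = proj₂ returned

    -- The adjacency of `Cycle length length≥3`, unfolded to positions in ℕ.
    Adjacent : ℕ → ℕ → Set
    Adjacent i j = (suc i ≡ j ⊎ (suc i ≡ length × j ≡ 0)) ⊎ (suc j ≡ i ⊎ (suc j ≡ length × i ≡ 0))

    walk-neighbour : ∀ {i y} → i < length → walk i ~ y → ∃[ j ] (j < length × walk j ≡ y × Adjacent i j)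
    walk-neighbour {suc i} 1+i<n i~y with ~-walk i i~y
    ... | inj₁ refl = i , ℕ.<-trans ℕ.≤-refl 1+i<n , refl , inj₂ (inj₁ refl)
    ... | inj₂ refl with ℕ.m≤n⇒m<n∨m≡n 1+i<n
    ...   | inj₁ 2+i<n = suc (suc i) , 2+i<n , refl , inj₁ (inj₁ refl)
    ...   | inj₂ 2+i≡n = 0 , ℕ.<-trans (s≤s z≤n) 1+i<n , trans (sym closed) (cong walk (sym 2+i≡n)) ,
                         inj₁ (inj₂ (2+i≡n , refl))
    walk-neighbour {zero} {y} _ a~y = at-start length refl
      where
      at-start : ∀ n → n ≡ length → ∃[ j ] (j < length × walk j ≡ y × Adjacent 0 j)
      at-start zero    eq with () ← subst (3 ≤_) (sym eq) length≥3
      -- The closing edge makes `walk m` a neighbour of `a`. It differs from `b`, which is `walk 1`,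
      -- because the length is at least three; so `y` is one of these two.
      at-start (suc m) eq with proj₁ (regular a) a~b
        (~-sym (subst (walk m ~_) (trans (cong walk eq) closed) (walk-~ m))) a~y
      ... | inj₁ b≡m = contradiction
        (walk-injective (ℕ.<-trans ℕ.≤-refl length≥3) (subst (m <_) eq ℕ.≤-refl) b≡m)
        λ { refl → ℕ.<-irrefl eq length≥3 }
      ... | inj₂ (inj₁ b≡y) = 1 , ℕ.<-trans ℕ.≤-refl length≥3 , b≡y , inj₁ (inj₁ refl)
      ... | inj₂ (inj₂ m≡y) = m , subst (m <_) eq ℕ.≤-refl , m≡y , inj₂ (inj₂ (eq , refl))

    private
      C = Cycle length length≥3
      module C = SimpleGraph C

      h : C.Vertex → Vertex
      h = walk ∘ toℕ

      h-injective : ∀ {i j} → h i ≡ h j → i ≡ j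
      h-injective = Fin.toℕ-injective ∘ walk-injective (Fin.toℕ<n _) (Fin.toℕ<n _)

      -- The visited vertices are closed under adjacency, so in a connected graph they are all
      -- vertices.
      reach : ∀ {x y} → Star _~_ x y → ∃[ j ] (j < length × walk j ≡ x) →
              ∃[ j ] (j < length × walk j ≡ y)
      reach ε p = p
      reach (x~y ◅ path) (j , j<n , refl) with k , k<n , eq , _ ← walk-neighbour j<n x~y =
        reach path (k , k<n , eq)

      h-surjective : ∀ x → ∃[ i ] h i ≡ x
      h-surjective x with j , j<n , eq ← reach (connected a x) (0 , ℕ.<-trans (s≤s z≤n) length≥3 , refl) =
        fromℕ< j<n , trans (cong walk (Fin.toℕ-fromℕ< j<n)) eq

      h-suc : ∀ {i j} → CyclicSuc i j → h i ~ h j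
      h-suc {i} (inj₁ eq)          = subst (λ k → h i ~ walk k) eq (walk-~ (toℕ i))
      h-suc {i} (inj₂ (eq , j≡0)) =
        subst (h i ~_) (trans (cong walk eq) (trans closed (cong walk (sym j≡0)))) (walk-~ (toℕ i))

      h-reflects : ∀ {i j} → h i ~ h j → i C.~ j
      h-reflects {i} {j} i~j with k , k<n , eq , adj ← walk-neighbour (Fin.toℕ<n i) i~j
        with refl ← walk-injective k<n (Fin.toℕ<n j) eq = adj

    cycle≅ : Cycle length length≥3 ≅ G
    cycle≅ = bijection⇒≅ {C} {G} h h-injective h-surjective [ h-suc , ~-sym ∘ h-suc ]′ h-reflects

    -- Phrased through `toℕ` because `length` is not visibly a successor, so `zero` cannot be
    -- written in `Fin length`.
    cycle≅-start : ∀ i → (toℕ i ≡ 0 → image cycle≅ i ≡ a) × (toℕ i ≡ 1 → image cycle≅ i ≡ b)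
    cycle≅-start i = cong walk , cong walk

  arc-transitive : ∀ {a b c d} → a ~ b → c ~ d → ∃[ ψ ] (actVertex G ψ a ≡ c × actVertex G ψ b ≡ d)
  arc-transitive {a} {b} {c} {d} a~b c~d =
    match W₁.length≥3 W₂.length≥3 (↔⇒≡ same) W₁.cycle≅ W₂.cycle≅ W₁.cycle≅-start W₂.cycle≅-start
    where
    module W₁ = Walk a~b
    module W₂ = Walk c~d

    -- Both lengths count the vertices of `G`, hence agree. They are variables in `match`, so that
    -- this equality can be eliminated.
    same : Fin W₁.length ↔ Fin W₂.length
    same = _≅_.bij (≅-trans W₁.cycle≅ (≅-sym W₂.cycle≅))

    match : ∀ {m n} (m≥3 : m ≥ 3) (n≥3 : n ≥ 3) → m ≡ n →
            (σ : Cycle m m≥3 ≅ G) (τ : Cycle n n≥3 ≅ G) →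
            (∀ i → (toℕ i ≡ 0 → image σ i ≡ a) × (toℕ i ≡ 1 → image σ i ≡ b)) →
            (∀ i → (toℕ i ≡ 0 → image τ i ≡ c) × (toℕ i ≡ 1 → image τ i ≡ d)) →
            ∃[ ψ ] (actVertex G ψ a ≡ c × actVertex G ψ b ≡ d)
    match m≥3@(s≤s (s≤s (s≤s _))) n≥3 refl σ τ σ-start τ-start with refl ← ℕ.≤-irrelevant m≥3 n≥3 =
      ≅-trans (≅-sym σ) τ
      , maps (proj₁ (σ-start zero) refl) (proj₁ (τ-start zero) refl)
      , maps (proj₂ (σ-start (suc zero)) refl) (proj₂ (τ-start (suc zero)) refl)
      where
      maps : ∀ {i x y} → image σ i ≡ x → image τ i ≡ y → image τ (image (≅-sym σ) x) ≡ y
      maps {i} refl refl = cong (image τ) (from-image σ i)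

  twoRegular⇒cycle : Vertex → ∃[ n ] Σ[ n≥3 ∈ n ≥ 3 ] G ≅ Cycle n n≥3
  twoRegular⇒cycle v with _ , v~b , _ ← proj₂ (regular v) v =
    Walk.length v~b , Walk.length≥3 v~b , ≅-sym (Walk.cycle≅ v~b)

  -- The arc from `v` to a neighbour `b` is moved to the arc from `w` to `to β b`; the other
  -- neighbour then has only one place to go.
  twoRegular⇒neighbourTransitive : NeighbourTransitive G
  twoRegular⇒neighbourTransitive v w β
    with b , v~b , _ ← proj₂ (regular v) v
    with ψ , ψv , ψb ← arc-transitive v~b (to-∈ β v~b) = ψ , ψv , ψN
    where
    ψN : ∀ {x} → v ~ x → actVertex G ψ x ≡ to β x
    ψN {x} v~x with x Fin.≟ b
    ... | yes refl = ψb
    ... | no  x≢b with proj₁ (regular w) (subst (_~ _) ψv (image-~ ψ v~x)) (to-∈ β v~x) (to-∈ β v~b)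
    ...   | inj₁ eq        = eq
    ...   | inj₂ (inj₁ eq) = contradiction (image-injective ψ (trans eq (sym ψb))) x≢b
    ...   | inj₂ (inj₂ eq) = contradiction (to-injective β v~x v~b eq) x≢b

cycle-twoRegular : ∀ n n≥3 → TwoRegular (Cycle n n≥3)
cycle-twoRegular n@(suc (suc (suc m))) n≥3@(s≤s (s≤s (s≤s _))) v = two , another-neighbour
  where
  open SimpleGraph (Cycle n n≥3)

  suc-unique : ∀ {i j k : Fin n} → CyclicSuc i j → CyclicSuc i k → j ≡ k
  suc-unique (inj₁ p) (inj₁ q) = Fin.toℕ-injective (trans (sym p) q)
  suc-unique {j = j} (inj₁ p) (inj₂ (q , _)) = contradiction (trans (sym p) q) (ℕ.<⇒≢ (Fin.toℕ<n j))
  suc-unique {k = k} (inj₂ (p , _)) (inj₁ q) = contradiction (trans (sym q) p) (ℕ.<⇒≢ (Fin.toℕ<n k))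
  suc-unique (inj₂ (_ , p)) (inj₂ (_ , q)) = Fin.toℕ-injective (trans p (sym q))

  pred-unique : ∀ {i j k : Fin n} → CyclicSuc j i → CyclicSuc k i → j ≡ k
  pred-unique (inj₁ p) (inj₁ q) = Fin.toℕ-injective (ℕ.suc-injective (trans p (sym q)))
  pred-unique (inj₁ p) (inj₂ (_ , q)) with () ← trans p q
  pred-unique (inj₂ (_ , p)) (inj₁ q) with () ← trans q p
  pred-unique (inj₂ (p , _)) (inj₂ (q , _)) = Fin.toℕ-injective (ℕ.suc-injective (trans p (sym q)))

  suc-exists : ∀ i → ∃[ j ] CyclicSuc {n} i j
  suc-exists i with ℕ.m≤n⇒m<n∨m≡n (Fin.toℕ<n i)
  ... | inj₁ 1+i<n = fromℕ< 1+i<n , inj₁ (sym (Fin.toℕ-fromℕ< 1+i<n))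
  ... | inj₂ 1+i≡n = zero , inj₂ (1+i≡n , refl)

  pred-exists : ∀ i → ∃[ j ] CyclicSuc {n} j i
  pred-exists zero    = Fin.fromℕ (suc (suc m)) , inj₂ (cong suc (Fin.toℕ-fromℕ _) , refl)
  pred-exists (suc i) = Fin.inject₁ i , inj₁ (cong suc (Fin.toℕ-inject₁ i))

  -- Successor and predecessor of a vertex are distinct. A case that wraps around would force length
  -- one or two.
  suc-asym : ∀ {i j : Fin n} → CyclicSuc i j → ¬ CyclicSuc j i
  suc-asym {i} {j} (inj₁ p) (inj₁ q) = ℕ.<-asym (ℕ.≤-reflexive p) (ℕ.≤-reflexive q)
  suc-asym (inj₁ p) (inj₂ (q , r)) with () ← trans (sym q) (cong suc (trans (sym p) (cong suc r)))
  suc-asym (inj₂ (p , r)) (inj₁ q) with () ← trans (sym p) (cong suc (trans (sym q) (cong suc r)))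
  suc-asym (inj₂ (p , _)) (inj₂ (_ , r)) with () ← trans (sym p) (cong suc r)

  two : AtMostTwo (v ~_)
  two (inj₁ p) (inj₁ q) _        = inj₁ (suc-unique p q)
  two (inj₁ p) (inj₂ _) (inj₁ r) = inj₂ (inj₁ (suc-unique p r))
  two (inj₁ _) (inj₂ q) (inj₂ r) = inj₂ (inj₂ (pred-unique q r))
  two (inj₂ p) (inj₂ q) _        = inj₁ (pred-unique p q)
  two (inj₂ p) (inj₁ _) (inj₂ r) = inj₂ (inj₁ (pred-unique p r))
  two (inj₂ _) (inj₁ q) (inj₁ r) = inj₂ (inj₂ (suc-unique q r))

  another-neighbour : ∀ a → ∃[ b ] (v ~ b × b ≢ a)
  another-neighbour a with suc-exists v | pred-exists v
  ... | s , v→s | p , p→v with s Fin.≟ a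
  ...   | no  s≢a  = s , inj₁ v→s , s≢a
  ...   | yes refl = p , inj₂ p→v , λ { refl → suc-asym v→s p→v }

-- Subdivisions

module _ (Γ : Multigraph) where
  open Multigraph Γ

  private
    module S = SimpleGraph (Subdivision Γ)

  old : Fin order → S.Vertex
  old v = v ↑ˡ size

  new : Fin size → S.Vertex
  new e = order ↑ʳ e

  data View : S.Vertex → Set where
    isOld : ∀ v → View (old v)
    isNew : ∀ e → View (new e)

  view : ∀ x → View x
  view x with splitAt order x in eq
  ... | inj₁ v = subst View (Fin.splitAt⁻¹-↑ˡ eq) (isOld v)
  ... | inj₂ e = subst View (Fin.splitAt⁻¹-↑ʳ eq) (isNew e)

  old-injective : ∀ {v w} → old v ≡ old w → v ≡ w
  old-injective = Fin.↑ˡ-injective size _ _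

  new-injective : ∀ {e f} → new e ≡ new f → e ≡ f
  new-injective = Fin.↑ʳ-injective order _ _

  ∈⇒old~new : ∀ {v e} → v ∈ᵉ e → old v S.~ new e
  ∈⇒old~new {v} {e} p rewrite Fin.splitAt-↑ˡ order v size | Fin.splitAt-↑ʳ order size e = p

  old~new⇒∈ : ∀ {v e} → old v S.~ new e → v ∈ᵉ e
  old~new⇒∈ {v} {e} p rewrite Fin.splitAt-↑ˡ order v size | Fin.splitAt-↑ʳ order size e = p

  old≁old : ∀ {v w} → ¬ old v S.~ old w
  old≁old {v} {w} p rewrite Fin.splitAt-↑ˡ order v size | Fin.splitAt-↑ˡ order w size = p

  new≁new : ∀ {e f} → ¬ new e S.~ new f
  new≁new {e} {f} p rewrite Fin.splitAt-↑ʳ order size e | Fin.splitAt-↑ʳ order size f = p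

  old-neighbour : ∀ {v x} → old v S.~ x → ∃[ e ] (x ≡ new e × v ∈ᵉ e)
  old-neighbour {v} {x} p with view x
  ... | isOld w = contradiction p (old≁old {v} {w})
  ... | isNew e = e , refl , old~new⇒∈ p

  new-neighbour : ∀ {e x} → new e S.~ x → ∃[ v ] (x ≡ old v × v ∈ᵉ e)
  new-neighbour {e} {x} p with view x
  ... | isOld v = v , refl , old~new⇒∈ (S.~-sym {new e} {old v} p)
  ... | isNew f = contradiction p (new≁new {e} {f})

  ends-AtMostTwo : ∀ e → AtMostTwo (_∈ᵉ e)
  ends-AtMostTwo e = λ where
    (inj₁ p) (inj₁ q) _        → inj₁ (trans p (sym q))
    (inj₂ p) (inj₂ q) _        → inj₁ (trans p (sym q))
    (inj₁ p) (inj₂ _) (inj₁ r) → inj₂ (inj₁ (trans p (sym r)))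
    (inj₂ p) (inj₁ _) (inj₂ r) → inj₂ (inj₁ (trans p (sym r)))
    (inj₁ _) (inj₂ q) (inj₂ r) → inj₂ (inj₂ (trans q (sym r)))
    (inj₂ _) (inj₁ q) (inj₁ r) → inj₂ (inj₂ (trans q (sym r)))

  new-AtMostTwo : ∀ e → AtMostTwo (new e S.~_)
  new-AtMostTwo e p q r with new-neighbour p | new-neighbour q | new-neighbour r
  ... | _ , refl , p′ | _ , refl , q′ | _ , refl , r′ =
    Sum.map (cong old) (Sum.map (cong old) (cong old)) (ends-AtMostTwo e p′ q′ r′)

  subdivision-lowEnds : LowEnds (Subdivision Γ)
  subdivision-lowEnds {u} {v} u~v with view u
  ... | isNew e = inj₁ (new-AtMostTwo e)
  ... | isOld w with e , refl , _ ← old-neighbour {w} u~v = inj₂ (new-AtMostTwo e)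

  mapBoth : (Fin order → Fin order) → (Fin size → Fin size) → S.Vertex → S.Vertex
  mapBoth f g x = [ old ∘ f , new ∘ g ]′ (splitAt order x)

  mapBoth-old : ∀ f g v → mapBoth f g (old v) ≡ old (f v)
  mapBoth-old f g v = cong [ old ∘ f , new ∘ g ]′ (Fin.splitAt-↑ˡ order v size)

  mapBoth-new : ∀ f g e → mapBoth f g (new e) ≡ new (g e)
  mapBoth-new f g e = cong [ old ∘ f , new ∘ g ]′ (Fin.splitAt-↑ʳ order size e)

  atOld : ∀ {v w} → (v ∈ᵉ_) ⇿ (w ∈ᵉ_) → (old v S.~_) ⇿ (old w S.~_)
  atOld {v} {w} β = record
    { to      = mapBoth id (to β)
    ; from    = mapBoth id (from β)
    ; to-∈    = maps (to β) (to-∈ β)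
    ; from-∈  = maps (from β) (from-∈ β)
    ; from-to = inverse (to β) (from β) (from-to β)
    ; to-from = inverse (from β) (to β) (to-from β)
    }
    where
    maps : ∀ {v w} (f : Fin size → Fin size) → (∀ {e} → v ∈ᵉ e → w ∈ᵉ f e) →
           ∀ {x} → old v S.~ x → old w S.~ mapBoth id f x
    maps {w = w} f f-∈ p with e , refl , v∈e ← old-neighbour p =
      subst (old w S.~_) (sym (mapBoth-new id f e)) (∈⇒old~new (f-∈ v∈e))

    inverse : ∀ {v} (f g : Fin size → Fin size) → (∀ {e} → v ∈ᵉ e → g (f e) ≡ e) →
              ∀ {x} → old v S.~ x → mapBoth id g (mapBoth id f x) ≡ x
    inverse f g gf p with e , refl , v∈e ← old-neighbour p =
      trans (cong (mapBoth id g) (mapBoth-new id f e))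
            (trans (mapBoth-new id g (f e)) (cong new (gf v∈e)))

  module _ {v w} (β : (old v S.~_) ⇿ (old w S.~_)) where

    edgePart : (S.Vertex → S.Vertex) → Fin size → Fin size
    -- The fallback `e` is for maps sending `new e` to an old vertex, which does not happen when
    -- `new e` goes to a neighbour of an old vertex.
    edgePart f e = [ (λ _ → e) , id ]′ (splitAt order (f (new e)))

    edgePart-new : ∀ (f : S.Vertex → S.Vertex) e {u} → old u S.~ f (new e) →
                   new (edgePart f e) ≡ f (new e) × u ∈ᵉ edgePart f e
    edgePart-new f e p with e′ , eq , u∈e′ ← old-neighbour p =
      trans (cong new part) (sym eq) , subst (_ ∈ᵉ_) (sym part) u∈e′
      where
      part : edgePart f e ≡ e′
      part = cong [ (λ _ → e) , id ]′ (trans (cong (splitAt order) eq) (Fin.splitAt-↑ʳ order size e′))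

    private
      to-new : ∀ {e} → v ∈ᵉ e → new (edgePart (to β) e) ≡ to β (new e) × w ∈ᵉ edgePart (to β) e
      to-new p = edgePart-new (to β) _ (to-∈ β (∈⇒old~new p))

      from-new : ∀ {e} → w ∈ᵉ e → new (edgePart (from β) e) ≡ from β (new e) × v ∈ᵉ edgePart (from β) e
      from-new p = edgePart-new (from β) _ (from-∈ β (∈⇒old~new p))

    ofOld : (v ∈ᵉ_) ⇿ (w ∈ᵉ_)
    ofOld = record
      { to      = edgePart (to β)
      ; from    = edgePart (from β)
      ; to-∈    = proj₂ ∘ to-new
      ; from-∈  = proj₂ ∘ from-new
      ; from-to = λ p → new-injective (trans (proj₁ (from-new (proj₂ (to-new p))))
                    (trans (cong (from β) (proj₁ (to-new p))) (from-to β (∈⇒old~new p))))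
      ; to-from = λ p → new-injective (trans (proj₁ (to-new (proj₂ (from-new p))))
                    (trans (cong (to β) (proj₁ (from-new p))) (to-from β (∈⇒old~new p))))
      }

    ofOld-new : ∀ {e} → v ∈ᵉ e → to β (new e) ≡ new (to ofOld e)
    ofOld-new p = sym (proj₁ (to-new p))

  automorphism-⇿ : ∀ (α : Automorphism) v → (v ∈ᵉ_) ⇿ ((onVertices α ⟨$⟩ʳ v) ∈ᵉ_)
  automorphism-⇿ α v = record
    { to      = E.to
    ; from    = E.from
    ; to-∈    = Equivalence.to (incidence α v _)
    ; from-∈  = λ p → Equivalence.from (incidence α v _)
                        (subst (_ ∈ᵉ_) (sym (E.strictlyInverseˡ _)) p)
    ; from-to = λ _ → E.strictlyInverseʳ _
    ; to-from = λ _ → E.strictlyInverseˡ _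
    }
    where module E = Inverse (onEdges α)

  subdivide : Automorphism → Aut (Subdivision Γ)
  subdivide α = bijection⇒≅ {Subdivision Γ} {Subdivision Γ} h
    (λ {x} {y} → h-injective x y) h-surjective (λ {x} {y} → preserves x y) (λ {x} {y} → reflects x y)
    where
    module V = Inverse (onVertices α)
    module E = Inverse (onEdges α)
    h = mapBoth V.to E.to

    h⁻¹ = mapBoth V.from E.from

    h⁻¹h : ∀ x → h⁻¹ (h x) ≡ x
    h⁻¹h x with view x
    ... | isOld v = trans (cong h⁻¹ (mapBoth-old V.to E.to v))
                      (trans (mapBoth-old V.from E.from _) (cong old (V.strictlyInverseʳ v)))
    ... | isNew e = trans (cong h⁻¹ (mapBoth-new V.to E.to e))
                      (trans (mapBoth-new V.from E.from _) (cong new (E.strictlyInverseʳ e)))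

    h-injective : ∀ x y → h x ≡ h y → x ≡ y
    h-injective x y eq = trans (sym (h⁻¹h x)) (trans (cong h⁻¹ eq) (h⁻¹h y))

    h-surjective : ∀ x → ∃[ y ] h y ≡ x
    h-surjective x with view x
    ... | isOld v = old (V.from v) , trans (mapBoth-old V.to E.to _) (cong old (V.strictlyInverseˡ v))
    ... | isNew e = new (E.from e) , trans (mapBoth-new V.to E.to _) (cong new (E.strictlyInverseˡ e))

    image-∈ : ∀ {v e} → v ∈ᵉ e → h (old v) S.~ h (new e)
    image-∈ {v} {e} p = subst₂ S._~_ (sym (mapBoth-old V.to E.to v)) (sym (mapBoth-new V.to E.to e))
                          (∈⇒old~new (Equivalence.to (incidence α v e) p))

    preserves : ∀ x y → x S.~ y → h x S.~ h y
    preserves x y x~y with view x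
    ... | isOld v with e , refl , v∈e ← old-neighbour {v} x~y = image-∈ v∈e
    ... | isNew e with v , refl , v∈e ← new-neighbour {e} x~y =
      S.~-sym {h (old v)} {h (new e)} (image-∈ v∈e)

    image-∈⁻¹ : ∀ {v e} → h (old v) S.~ h (new e) → old v S.~ new e
    image-∈⁻¹ {v} {e} p = ∈⇒old~new (Equivalence.from (incidence α v e) (old~new⇒∈
      (subst₂ S._~_ (mapBoth-old V.to E.to v) (mapBoth-new V.to E.to e) p)))

    reflects : ∀ x y → h x S.~ h y → x S.~ y
    reflects x y p with view x | view y
    ... | isOld v | isNew e = image-∈⁻¹ p
    ... | isNew e | isOld v = S.~-sym {old v} {new e} (image-∈⁻¹ (S.~-sym {h (new e)} {h (old v)} p))
    ... | isOld v | isOld w = contradiction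
      (subst₂ S._~_ (mapBoth-old V.to E.to v) (mapBoth-old V.to E.to w) p)
      (old≁old {V.to v} {V.to w})
    ... | isNew e | isNew f = contradiction
      (subst₂ S._~_ (mapBoth-new V.to E.to e) (mapBoth-new V.to E.to f) p)
      (new≁new {E.to e} {E.to f})

  subdivide-old : ∀ α v → image (subdivide α) (old v) ≡ old (onVertices α ⟨$⟩ʳ v)
  subdivide-old α = mapBoth-old _ _

  subdivide-new : ∀ α e → image (subdivide α) (new e) ≡ new (onEdges α ⟨$⟩ʳ e)
  subdivide-new α = mapBoth-new _ _

  module _ {k} (k≥3 : k ≥ 3) (valent : HasValency Γ k) where

    edges : ∀ v → Enumeration (v ∈ᵉ_) k
    edges v = enumerate-≡ (v ∈ᵉ?_) (valent v)

    -- Valency at least three tells old vertices from new ones, so no bijection of neighbourhoods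
    -- and no automorphism mixes the two kinds.
    old-¬AtMostTwo : ∀ v → ¬ AtMostTwo (old v S.~_)
    old-¬AtMostTwo v two = enumeration₃⇒¬AtMostTwo k≥3 (edges v) λ p q r →
      Sum.map new-injective (Sum.map new-injective new-injective)
        (two (∈⇒old~new p) (∈⇒old~new q) (∈⇒old~new r))

    subdivision-neighbourTransitive : LocallyFullySymmetric Γ → ArcTransitive Γ →
                                      NeighbourTransitive (Subdivision Γ)
    subdivision-neighbourTransitive lfs arcTransitive x y β with view x | view y
    ... | isOld v | isNew e = ⊥-elim (old-¬AtMostTwo v (⇿-AtMostTwo β (new-AtMostTwo e)))
    ... | isNew e | isOld v = ⊥-elim (old-¬AtMostTwo v (⇿-AtMostTwo (⇿-sym β) (new-AtMostTwo e)))
    ... | isNew e | isNew f = atNew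
      where
      -- One end of `e` is singled out. Arc-transitivity moves it to the end of `f` prescribed by
      -- `β`, and the other end follows.
      v₁ = end₁ e
      e~v₁ : new e S.~ old v₁
      e~v₁ = S.~-sym {old v₁} {new e} (∈⇒old~new (inj₁ refl))

      atNew : ∃[ ψ ] (actVertex (Subdivision Γ) ψ (new e) ≡ new f
                    × (∀ {x} → new e S.~ x → actVertex (Subdivision Γ) ψ x ≡ to β x))
      atNew with w , βv₁ , w∈f ← new-neighbour {f} (to-∈ β e~v₁)
        with α , αv , αe ← arcTransitive ((v₁ , e) , [ inj₁ refl ]) ((w , f) , [ w∈f ]) =
        ψ , ψe , ψN
        where
        ψ = subdivide α
        ψe : image ψ (new e) ≡ new f
        ψe = trans (subdivide-new α e) (cong new αe)
        ψv₁ : image ψ (old v₁) ≡ to β (old v₁)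
        ψv₁ = trans (subdivide-old α v₁) (trans (cong old αv) (sym βv₁))
        ψN : ∀ {x} → new e S.~ x → image ψ x ≡ to β x
        ψN {x} e~x with x Fin.≟ old v₁
        ... | yes refl = ψv₁
        ... | no  x≢v₁ with new-AtMostTwo f {image ψ x} {to β x} {to β (old v₁)}
                              (subst (S._~ image ψ x) ψe (image-~ ψ {new e} {x} e~x))
                              (to-∈ β e~x) (to-∈ β e~v₁)
        ...   | inj₁ eq        = eq
        ...   | inj₂ (inj₁ eq) = contradiction (image-injective ψ (trans eq (sym ψv₁))) x≢v₁
        ...   | inj₂ (inj₂ eq) = contradiction (to-injective β e~x e~v₁ eq) x≢v₁
    ... | isOld v | isOld w = atOld′
      where
      γ : (v ∈ᵉ_) ⇿ (w ∈ᵉ_)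
      γ = ofOld β

      atOld′ : ∃[ ψ ] (actVertex (Subdivision Γ) ψ (old v) ≡ old w
                     × (∀ {x} → old v S.~ x → actVertex (Subdivision Γ) ψ x ≡ to β x))
      atOld′ with e , v∈e ← enumeration⇒∃ (ℕ.≤-trans (s≤s z≤n) k≥3) (edges v)
        -- `α` carries `v` to `w` but may permute the edges wrongly. The correction, the inverse of
        -- `α` followed by `γ`, permutes the edges at `w` and is realised by a local symmetry.
        with α , refl , _ ← arcTransitive ((v , e) , [ v∈e ]) ((w , to γ e) , [ to-∈ γ v∈e ])
        with α′ , α′w , α′N ← lfs w (⇿⇒↔ (w ∈ᵉ?_) (w ∈ᵉ?_) (⇿-trans (⇿-sym (automorphism-⇿ α v)) γ)) =
        ≅-trans (subdivide α) (subdivide α′)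
        , trans (cong (image (subdivide α′)) (subdivide-old α v))
            (trans (subdivide-old α′ _) (cong old α′w))
        , ψN
        where
        ψN : ∀ {x} → old v S.~ x → image (subdivide α′) (image (subdivide α) x) ≡ to β x
        ψN v~x with f , refl , v∈f ← old-neighbour {v} v~x =
          trans (cong (image (subdivide α′)) (subdivide-new α f))
            (trans (subdivide-new α′ _)
              (trans (cong new (trans (α′N (_ , [ to-∈ (automorphism-⇿ α v) v∈f ]))
                                 (cong (to γ) (from-to (automorphism-⇿ α v) v∈f))))
                     (sym (ofOld-new β v∈f))))

    module _ (ψ : Aut (Subdivision Γ)) where

      old↦old : ∀ v → ∃[ w ] image ψ (old v) ≡ old w
      old↦old v = classify (view (image ψ (old v))) refl
        where
        classify : ∀ {x} → View x → image ψ (old v) ≡ x → ∃[ w ] image ψ (old v) ≡ old w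
        classify (isOld w) eq = w , eq
        classify (isNew e) eq = ⊥-elim (old-¬AtMostTwo v
          (⇿-AtMostTwo (image-⇿ ψ (old v))
            (subst (λ x → AtMostTwo (x S.~_)) (sym eq) (new-AtMostTwo e))))

      new↦new : ∀ e → ∃[ f ] image ψ (new e) ≡ new f
      new↦new e = classify (view (image ψ (new e))) refl
        where
        classify : ∀ {x} → View x → image ψ (new e) ≡ x → ∃[ f ] image ψ (new e) ≡ new f
        classify (isNew f) eq = f , eq
        classify (isOld v) eq = ⊥-elim (old-¬AtMostTwo v
          (subst (λ x → AtMostTwo (x S.~_)) eq
            (⇿-AtMostTwo (⇿-sym (image-⇿ ψ (new e))) (new-AtMostTwo e))))

    -- Old vertices go to old ones and new to new, so `ψ` acts on the vertices and on the edges of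
    -- `Γ`; adjacency in the subdivision is incidence in `Γ`.
    contract : Aut (Subdivision Γ) → Automorphism
    contract ψ = record
      { onVertices = permutation (proj₁ ∘ old↦old ψ) (proj₁ ∘ old↦old ψ⁻¹)
          (old-inverse ψ⁻¹ ψ (image-from ψ)) (old-inverse ψ ψ⁻¹ (from-image ψ))
      ; onEdges    = permutation (proj₁ ∘ new↦new ψ) (proj₁ ∘ new↦new ψ⁻¹)
          (new-inverse ψ⁻¹ ψ (image-from ψ)) (new-inverse ψ ψ⁻¹ (from-image ψ))
      ; incidence  = λ v e → mk⇔
          (λ p → old~new⇒∈ (subst₂ S._~_ (proj₂ (old↦old ψ v)) (proj₂ (new↦new ψ e))
                   (image-~ ψ {old v} {new e} (∈⇒old~new p))))
          (λ p → old~new⇒∈ (Equivalence.from (_≅_.preserve ψ (old v) (new e))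
                   (subst₂ S._~_ (sym (proj₂ (old↦old ψ v))) (sym (proj₂ (new↦new ψ e)))
                     (∈⇒old~new p))))
      }
      where
      ψ⁻¹ = ≅-sym ψ

      old-inverse : ∀ σ τ → (∀ x → image τ (image σ x) ≡ x) →
                    ∀ v → proj₁ (old↦old τ (proj₁ (old↦old σ v))) ≡ v
      old-inverse σ τ τσ v = old-injective
        (trans (sym (proj₂ (old↦old τ _))) (trans (cong (image τ) (sym (proj₂ (old↦old σ v)))) (τσ _)))

      new-inverse : ∀ σ τ → (∀ x → image τ (image σ x) ≡ x) →
                    ∀ e → proj₁ (new↦new τ (proj₁ (new↦new σ e))) ≡ e
      new-inverse σ τ τσ e = new-injective
        (trans (sym (proj₂ (new↦new τ _))) (trans (cong (image τ) (sym (proj₂ (new↦new σ e)))) (τσ _)))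

    contract-old : ∀ ψ {v w} → image ψ (old v) ≡ old w → onVertices (contract ψ) ⟨$⟩ʳ v ≡ w
    contract-old ψ {v} eq = old-injective (trans (sym (proj₂ (old↦old ψ v))) eq)

    contract-new : ∀ ψ {e f} → image ψ (new e) ≡ new f → onEdges (contract ψ) ⟨$⟩ʳ e ≡ f
    contract-new ψ {e} eq = new-injective (trans (sym (proj₂ (new↦new ψ e))) eq)

    extends : NeighbourTransitive (Subdivision Γ) → ∀ {v w} (β : (v ∈ᵉ_) ⇿ (w ∈ᵉ_)) →
              ∃[ α ] (onVertices α ⟨$⟩ʳ v ≡ w × (∀ {e} → v ∈ᵉ e → onEdges α ⟨$⟩ʳ e ≡ to β e))
    extends nt {v} {w} β with ψ , ψv , ψN ← nt (old v) (old w) (atOld β) =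
      contract ψ , contract-old ψ ψv ,
      λ {e} p → contract-new ψ (trans (ψN (∈⇒old~new p)) (mapBoth-new id (to β) e))

    neighbourTransitive⇒locallyFullySymmetric : NeighbourTransitive (Subdivision Γ) →
                                                LocallyFullySymmetric Γ
    neighbourTransitive⇒locallyFullySymmetric nt v π
      with α , αv , αN ← extends nt (↔⇒⇿ (v ∈ᵉ?_) (v ∈ᵉ?_) π) =
      α , αv , λ { x@(e , [ p ]) → trans (αN (recompute (v ∈ᵉ? e) p))
                                         (extend-∈ (v ∈ᵉ?_) (Inverse.to π) x) }

    -- Equal degrees give some bijection from the edges at `v` to those at `w`; a transposition then
    -- redirects the image of `e` to `f`.
    neighbourTransitive⇒arcTransitive : NeighbourTransitive (Subdivision Γ) → ArcTransitive Γ
    neighbourTransitive⇒arcTransitive nt ((v , e) , [ p ]) ((w , f) , [ q ]) =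
      let α , αv , αN = extends nt (⇿-trans β (swap-⇿ (to-∈ β v∈e) w∈f))
      in  α , αv , trans (αN v∈e) (swap-left (to β e) f)
      where
      v∈e = recompute (v ∈ᵉ? e) p
      w∈f = recompute (w ∈ᵉ? f) q
      β : (v ∈ᵉ_) ⇿ (w ∈ᵉ_)
      β = equinumerous⇒⇿ (v ∈ᵉ?_) (w ∈ᵉ?_) (edges v) (edges w)

-- Suppressing the vertices of valency two

module _ (G : SimpleGraph) {k : ℕ} (k≥3 : k ≥ 3) (bivalent : Bivalent G k) where
  open SimpleGraph G using (_~_; _~?_; ~-sym; ~-irrefl)

  private
    big? : Decidable (λ x → valency G x ≡ k)
    big? x = valency G x ℕ.≟ k

    small? : Decidable (λ x → valency G x ≡ 2)
    small? x = valency G x ℕ.≟ 2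

    abstract
      B : Enumeration (λ x → valency G x ≡ k) (count big? (allFin _))
      B = enumerate big?

      S : Enumeration (λ x → valency G x ≡ 2) (count small? (allFin _))
      S = enumerate small?

    big⇒¬small : ∀ {x} → valency G x ≡ k → valency G x ≢ 2
    big⇒¬small xₖ x₂ = ℕ.<⇒≢ k≥3 (trans (sym x₂) xₖ)

    small-neighbour : ∀ {x y} → valency G x ≡ 2 → x ~ y → valency G y ≡ k
    small-neighbour {x} x₂ with bivalent x
    ... | inj₁ (_ , N)  = N
    ... | inj₂ (xₖ , _) = contradiction x₂ (big⇒¬small xₖ)

    big-neighbour : ∀ {x y} → valency G x ≡ k → x ~ y → valency G y ≡ 2
    big-neighbour {x} xₖ with bivalent x
    ... | inj₂ (_ , N)  = N
    ... | inj₁ (x₂ , _) = contradiction x₂ (big⇒¬small xₖ)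

    abstract
      -- The two neighbours of a vertex of valency two have valency `k` and become the ends of the
      -- edge that replaces it. Their distinctness excludes loops, while two such vertices with the
      -- same neighbours yield parallel edges.
      ends : ∀ e → ∃[ i ] ∃[ j ] (element B i ~ element S e × element B j ~ element S e × i ≢ j)
      ends e with enumeration⇒∃₂ ℕ.≤-refl (enumerate-≡ (element S e ~?_) (element-∈ S e))
      ... | x , y , e~x , e~y , x≢y =
        index B x xₖ , index B y yₖ ,
        subst (_~ _) (sym (element-index B x xₖ)) (~-sym e~x) ,
        subst (_~ _) (sym (element-index B y yₖ)) (~-sym e~y) ,
        x≢y ∘ index-injective B xₖ yₖ
        where
        xₖ : valency G x ≡ k
        xₖ = small-neighbour (element-∈ S e) e~x
        yₖ : valency G y ≡ k
        yₖ = small-neighbour (element-∈ S e) e~y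

  suppressed : Multigraph
  suppressed = record
    { order    = count big? (allFin _)
    ; size     = count small? (allFin _)
    ; end₁     = λ e → proj₁ (ends e)
    ; end₂     = λ e → proj₁ (proj₂ (ends e))
    ; loopless = λ e → proj₂ (proj₂ (proj₂ (proj₂ (ends e))))
    }

  private
    open Multigraph suppressed using (_∈ᵉ_; _∈ᵉ?_)

    ∈⇒~ : ∀ {v e} → v ∈ᵉ e → element B v ~ element S e
    ∈⇒~ {e = e} (inj₁ refl) = proj₁ (proj₂ (proj₂ (ends e)))
    ∈⇒~ {e = e} (inj₂ refl) = proj₁ (proj₂ (proj₂ (proj₂ (ends e))))

    -- A vertex of valency two has no third neighbour besides its two chosen ends.
    ~⇒∈ : ∀ {v e} → element B v ~ element S e → v ∈ᵉ e
    ~⇒∈ {v} {e} v~e with i , j , i~e , j~e , i≢j ← ends e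
      with enumeration₂⇒AtMostTwo (enumerate-≡ (element S e ~?_) (element-∈ S e))
             (~-sym v~e) (~-sym i~e) (~-sym j~e)
    ... | inj₁ v≡i        = inj₁ (element-injective B v≡i)
    ... | inj₂ (inj₁ v≡j) = inj₂ (element-injective B v≡j)
    ... | inj₂ (inj₂ i≡j) = contradiction (element-injective B i≡j) i≢j

  -- All neighbours of a vertex of valency `k` have valency two, so they correspond to the edges at
  -- it in the multigraph.
  suppressed-valent : HasValency suppressed k
  suppressed-valent v = trans
    (ℕ.≤-antisym
      (count-≤ (v ∈ᵉ?_) (element B v ~?_) (λ e _ → element S e) (λ _ → ∈⇒~)
        (λ _ _ → element-injective S))
      (count-≤ (element B v ~?_) (v ∈ᵉ?_) (λ x v~x → index S x (big-neighbour (element-∈ B v) v~x))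
        (λ x v~x → ~⇒∈ (subst (element B v ~_) (sym (element-index S x _)) v~x))
        (λ _ _ → index-injective S _ _)))
    (element-∈ B v)

  -- Each vertex has valency `k` or 2, and never both as `k ≥ 3`. Listing the two kinds one after
  -- the other therefore meets every vertex of `G` once, and edges join only vertices of different
  -- kinds.
  subdivision≅ : G ≅ Subdivision suppressed
  subdivision≅ = ≅-sym (bijection⇒≅ {Subdivision suppressed} {G} h
    (λ {x} {y} → h-injective x y) h-surjective (λ {x} {y} → preserves x y) (λ {x} {y} → reflects x y))
    where
    module Γ = Multigraph suppressed
    module D = SimpleGraph (Subdivision suppressed)
    old′ = old suppressed
    new′ = new suppressed

    h : D.Vertex → SimpleGraph.Vertex G
    h x = [ element B , element S ]′ (splitAt Γ.order x)

    h-old : ∀ v → h (old′ v) ≡ element B v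
    h-old v = cong [ element B , element S ]′ (Fin.splitAt-↑ˡ Γ.order v Γ.size)

    h-new : ∀ e → h (new′ e) ≡ element S e
    h-new e = cong [ element B , element S ]′ (Fin.splitAt-↑ʳ Γ.order Γ.size e)

    h-big : ∀ v → valency G (h (old′ v)) ≡ k
    h-big v = trans (cong (valency G) (h-old v)) (element-∈ B v)

    h-small : ∀ e → valency G (h (new′ e)) ≡ 2
    h-small e = trans (cong (valency G) (h-new e)) (element-∈ S e)

    h-injective : ∀ x y → h x ≡ h y → x ≡ y
    h-injective x y eq with view suppressed x | view suppressed y
    ... | isOld v | isOld w = cong old′ (element-injective B (trans (sym (h-old v)) (trans eq (h-old w))))
    ... | isNew e | isNew f = cong new′ (element-injective S (trans (sym (h-new e)) (trans eq (h-new f))))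
    ... | isOld v | isNew e =
      contradiction (trans (cong (valency G) eq) (h-small e)) (big⇒¬small (h-big v))
    ... | isNew e | isOld v =
      contradiction (trans (cong (valency G) (sym eq)) (h-small e)) (big⇒¬small (h-big v))

    h-surjective : ∀ x → ∃[ y ] h y ≡ x
    h-surjective x with bivalent x
    ... | inj₁ (x₂ , _) = new′ (index S x x₂) , trans (h-new _) (element-index S x x₂)
    ... | inj₂ (xₖ , _) = old′ (index B x xₖ) , trans (h-old _) (element-index B x xₖ)

    h-∈ : ∀ {v e} → v Γ.∈ᵉ e → h (old′ v) ~ h (new′ e)
    h-∈ {v} {e} p = subst₂ _~_ (sym (h-old v)) (sym (h-new e)) (∈⇒~ p)

    h-∈⁻¹ : ∀ {v e} → h (old′ v) ~ h (new′ e) → old′ v D.~ new′ e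
    h-∈⁻¹ {v} {e} p = ∈⇒old~new suppressed (~⇒∈ (subst₂ _~_ (h-old v) (h-new e) p))

    preserves : ∀ x y → x D.~ y → h x ~ h y
    preserves x y x~y with view suppressed x
    ... | isOld v with e , refl , v∈e ← old-neighbour suppressed {v} x~y = h-∈ v∈e
    ... | isNew e with v , refl , v∈e ← new-neighbour suppressed {e} x~y = ~-sym (h-∈ v∈e)

    reflects : ∀ x y → h x ~ h y → x D.~ y
    reflects x y p with view suppressed x | view suppressed y
    ... | isOld v | isNew e = h-∈⁻¹ p
    ... | isNew e | isOld v = D.~-sym {old′ v} {new′ e} (h-∈⁻¹ (~-sym p))
    ... | isOld v | isOld w = contradiction (big-neighbour (h-big v) p) (big⇒¬small (h-big w))
    ... | isNew e | isNew f = contradiction (h-small f) (big⇒¬small (small-neighbour (h-small e) p))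

-- The classification

valency₂⇒twoRegular : ∀ G → (∀ v → valency G v ≡ 2) → TwoRegular G
valency₂⇒twoRegular G all₂ v =
  enumeration₂⇒AtMostTwo E , another ℕ.≤-refl E
  where E = enumerate-≡ (SimpleGraph._~?_ G v) (all₂ v)

theorem1p3 : (L : SimpleGraph) →
    Connected L →
    HasMinimalValency L 1 ⊎ HasMinimalValency L 2 →
    (StarTransitive L × StEdgeTransitive L)
    ⇔
    ( (∃[ n ] (n ≥ 1 × L ≅ CompleteBipartite 1 n))
    ⊎ (∃[ n ] Σ[ n≥3 ∈ n ≥ 3 ] L ≅ Cycle n n≥3)
    ⊎ (Σ[ Γ ∈ Multigraph ]
    ( LocallyFullySymmetric Γ
    × ArcTransitive Γ
    × (∃[ k ] (k ≥ 3 × HasValency Γ k))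
    × L ≅ Subdivision Γ)))
theorem1p3 L connected minimal = mk⇔
  (λ (starTransitive , _) →
     classify (starTransitive⇒neighbourTransitive L starTransitive) minimal)
  λ where
    (inj₁ (n , _ , σ)) → transitive
      (NeighbourTransitive-≅ σ (isStar-neighbourTransitive (CompleteBipartite 1 n) (completeBipartite-isStar n)))
      (LowEnds-≅ σ (λ {u} {v} → isStar-lowEnds (CompleteBipartite 1 n) (completeBipartite-isStar n) {u} {v}))
    (inj₂ (inj₁ (n , n≥3 , σ))) →
      let regular = TwoRegular-≅ σ (cycle-twoRegular n n≥3) in
      transitive (twoRegular⇒neighbourTransitive L connected regular)
                 (λ {u} _ → inj₁ (proj₁ (regular u)))
    (inj₂ (inj₂ (Γ , lfs , arcTransitive , (_ , k≥3 , valent) , σ))) → transitive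
      (NeighbourTransitive-≅ σ (subdivision-neighbourTransitive Γ k≥3 valent lfs arcTransitive))
      (LowEnds-≅ σ (λ {u} {v} → subdivision-lowEnds Γ {u} {v}))
  where
  transitive : NeighbourTransitive L → LowEnds L → StarTransitive L × StEdgeTransitive L
  transitive nt low = neighbourTransitive⇒starTransitive L nt
                    , neighbourTransitive⇒stEdgeTransitive L nt low

  classify : NeighbourTransitive L → HasMinimalValency L 1 ⊎ HasMinimalValency L 2 → _
  classify nt (inj₁ (leaf , _)) = inj₁ (leaf⇒star L connected nt leaf)
  classify nt (inj₂ ((v , v₂) , 2≤))
    with k , (u , uₖ) , biv ← neighbourTransitive⇒bivalent L connected nt v₂
    -- Since `k` is the valency of `u`, it is at least the minimal valency two. Equality gives a
    -- cycle, strict inequality a subdivision.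
    with ℕ.m≤n⇒m<n∨m≡n (subst (2 ≤_) uₖ (2≤ u))
  ... | inj₂ refl = inj₂ (inj₁ (twoRegular⇒cycle L connected
                      (valency₂⇒twoRegular L λ x → [ proj₁ , proj₁ ]′ (biv x)) v))
  ... | inj₁ k≥3 = inj₂ (inj₂ (Γ
                   , neighbourTransitive⇒locallyFullySymmetric Γ k≥3 Γ-valent nt′
                   , neighbourTransitive⇒arcTransitive Γ k≥3 Γ-valent nt′
                   , (k , k≥3 , Γ-valent)
                   , subdivision≅ L k≥3 biv))
    where
    Γ = suppressed L k≥3 biv
    Γ-valent = suppressed-valent L k≥3 biv
    nt′ = NeighbourTransitive-≅ (≅-sym (subdivision≅ L k≥3 biv)) nt
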